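{- Let $n \geq 2$ and let $t_1,\dots,t_n$ be integers with $t_i \geq 3$ for all $i$. Let $\mathcal{P}_4$ be the family of planar graphs having girth at least $4$. Then in every play of the game $BS_n(\mathcal{P}_4 : t_1, t_2, \dots, t_n)$ the number $x$ of moves after which the game ends satisfies $$4+n \;\leq\; x \;\leq\; (n-2) + \sum_{i=1}^n t_i .$$
   Context: The girth of a graph is the length of a shortest cycle (infinite if there is no cycle); a pair of parallel edges counts as a cycle of length 2. The game $BS_n(\mathcal{P}_4:t_1,\dots,t_n)$ ($n$-Brussels sprout for $\mathcal{P}_4$) is the following two-player game, drawn in the plane. Initially there are $n$ spots (vertices), the $i$-th spot having $t_i$ open tips (short free partial edges) coming out of it. The players move alternately. A valid move consists of joining two distinct open tips by a curve that crosses neither itself nor any previously drawn curve, and then drawing a crossbar on this curve: the intersection of the crossbar with the curve is a new vertex, which has two new open tips, one on each side of the curve. The two joined tips are no longer open. The associated graph has as vertices the spots and the curve/crossbar intersections, and as edges the curve pieces joining two such vertices (so each move adds one vertex and two edges); it must belong to $\mathcal{P}_4$ at all times. The game ends when no valid move exists, and the first player unable to make a valid move loses. The number of moves is the total number of moves made by both players. -}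

module Defs where

open import Data.Fin using (Fin; toℕ)
open import Data.List using (List; []; _∷_; _++_; _∷ʳ_; [_]; length; lookup; replicate; tabulate)
open import Data.List.Relation.Binary.Permutation.Propositional using (_↭_)
open import Data.Nat using (ℕ; suc; _≤_)
open import Data.Nat.DivMod using (_mod_)
open import Data.Product using (_×_; _,_; ∃-syntax)
open import Data.Sum using (_⊎_)
open import Function.Definitions using (Injective)
open import Relation.Binary.PropositionalEquality using (_≡_)
open import Relation.Nullary using (¬_)

-- The vertices are 0, …, order - 1.  Loops and repeated entries (parallel
-- edges) are possible, and the order of the two entries of a pair is
-- irrelevant.
record Multigraph : Set where
  constructor mkGraph
  field
    order : ℕ
    edges : List (ℕ × ℕ)
open Multigraph public

Joins : ℕ × ℕ → ℕ → ℕ → Set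
Joins e u v = (e ≡ (u , v)) ⊎ (e ≡ (v , u))

-- A cycle of length suc k.  Edges are identified by their index in the list,
-- so that two parallel edges form a cycle of length 2 (while a single edge
-- traversed back and forth does not) and a loop is a cycle of length 1.
record Cycle (G : Multigraph) (k : ℕ) : Set where
  field
    vertex          : Fin (suc k) → ℕ
    edge            : Fin (suc k) → Fin (length (edges G))
    vertex-distinct : Injective _≡_ _≡_ vertex
    edge-distinct   : Injective _≡_ _≡_ edge
    joins           : ∀ i → Joins (lookup (edges G) (edge i))
                                  (vertex i) (vertex (suc (toℕ i) mod suc k))

-- The girth is the infimum of the cycle lengths (infinite if there are none).
GirthAtLeast : ℕ → Multigraph → Set
GirthAtLeast g G = ∀ k → Cycle G k → g ≤ suc k

-- Plane drawings with open tips, recorded up to homeomorphism.  A region is a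
-- connected component of the complement of the drawing.  Each connected
-- component of its frontier is recorded by the cyclic sequence of open tips
-- met when walking along it with the region on the left; a tip is represented
-- by the vertex it comes out of, and different tips are different positions
-- in these sequences.  Frontier components without open tips are the empty
-- sequence.  Regions, and frontier components of a region, are unordered.
-- The unbounded region plays no special role.
Boundary : Set
Boundary = List ℕ

Region : Set
Region = List Boundary

-- The lists represent the same cyclic sequence.
data _↻_ : Boundary → Boundary → Set where
  rotate : ∀ as bs → (as ++ bs) ↻ (bs ++ as)

-- Curve s u v Rs Rs′: starting from regions Rs, a curve joining a tip of u to
-- a different tip of v is drawn inside one region, without crossings, and
-- results in regions Rs′.  On each side of the curve the new tips s appear
-- (s = [] for a bare edge; s = [ w ] for a crossbar with intersection w).
--  * across: the tips lie on different frontier components.  These merge, the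
--    walk following both sides of the curve, and the region stays connected.
--  * within: the tips lie on the same frontier component.  The region is cut in
--    two, its remaining frontier components R₁ ++ R₂ being distributed over the
--    two sides in an arbitrary way.
data Curve (s : List ℕ) (u v : ℕ) (Rs : List Region) : List Region → Set where
  across : ∀ {X Ss b c xs ys R} →
           Rs ↭ X ∷ Ss →
           X ↭ b ∷ c ∷ R →
           b ↻ (u ∷ xs) →
           c ↻ (v ∷ ys) →
           Curve s u v Rs (((xs ++ s ++ ys ++ s) ∷ R) ∷ Ss)
  within : ∀ {X Ss b xs ys R₁ R₂} →
           Rs ↭ X ∷ Ss →
           X ↭ b ∷ R₁ ++ R₂ →
           b ↻ (u ∷ xs ++ v ∷ ys) →
           Curve s u v Rs (((xs ++ s) ∷ R₁) ∷ ((s ++ ys) ∷ R₂) ∷ Ss)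

-- Drawn G Rs: G has a plane drawing with regions Rs.  Drawings are built from
-- the empty plane by placing a new vertex, with any number d of tips, inside a
-- region, and by joining tips; every plane drawing arises in this way (cut each
-- edge into two tips, then restore the edges one by one).
data Drawn : Multigraph → List Region → Set where
  blank      : Drawn (mkGraph 0 []) [ [] ]
  add-vertex : ∀ {m E Rs X Ss} (d : ℕ) →
               Drawn (mkGraph m E) Rs →
               Rs ↭ X ∷ Ss →
               Drawn (mkGraph (suc m) E) ((X ∷ʳ replicate d m) ∷ Ss)
  add-edge   : ∀ {m E Rs Rs′ u v} →
               Drawn (mkGraph m E) Rs →
               Curve [] u v Rs Rs′ →
               Drawn (mkGraph m ((u , v) ∷ E)) Rs′

Planar : Multigraph → Set
Planar G = ∃[ Rs ] Drawn G Rs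

𝒫₄ : Multigraph → Set
𝒫₄ G = Planar G × GirthAtLeast 4 G

-- A position of the game; graph is the associated graph.
record Position : Set where
  constructor mkPosition
  field
    graph   : Multigraph
    regions : List Region
open Position public

initial : ∀ {n} → (Fin n → ℕ) → Position
initial {n} t = mkPosition (mkGraph n []) [ tabulate (λ i → replicate (t i) (toℕ i)) ]

-- The new vertex, where the crossbar meets the curve, is order (graph P).
data Move (𝒫 : Multigraph → Set) (P : Position) : Position → Set where
  move : ∀ {u v Rs} →
         let w = order (graph P)
             G = mkGraph (suc w) ((u , w) ∷ (w , v) ∷ edges (graph P))
         in Curve [ w ] u v (regions P) Rs →
            𝒫 G →
            Move 𝒫 P (mkPosition G Rs)

Ended : (Multigraph → Set) → Position → Set
Ended 𝒫 P = ¬ (∃[ Q ] Move 𝒫 P Q)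

-- Play 𝒫 t x P: position P is reached after x moves, counting those of both
-- players.
data Play (𝒫 : Multigraph → Set) {n} (t : Fin n → ℕ) : ℕ → Position → Set where
  start : Play 𝒫 t 0 (initial t)
  next  : ∀ {x P Q} → Play 𝒫 t x P → Move 𝒫 P Q → Play 𝒫 t (suc x) Q

InfinitePlay : (Multigraph → Set) → ∀ {n} → (Fin n → ℕ) → (ℕ → Position) → Set
InfinitePlay 𝒫 t f = (f 0 ≡ initial t) × (∀ k → Move 𝒫 (f k) (f (suc k)))

{-# OPTIONS --safe #-}

-- Joining tips on different frontier components of a region lowers the number c
-- of components by one, joining tips on the same component raises both c and the
-- number r of regions by one; hence x + c + 2 = 2r + n after x moves.  Open tips
-- are conserved and every region has at least one, so r ≤ Σ tᵢ, which with r ≤ c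
-- gives the upper bound.  In an ended position c = r, because different
-- components of a region carry distinct, non-adjacent vertices and so can always
-- be joined; the lower bound then amounts to r ≥ 6.
--
-- Two tips on one component can be joined exactly when their vertices are distinct
-- and non-adjacent.  Weigh a region by 1, or by the number of cyclic changes of
-- letter along one of its components that still has such a pair.  No move lowers
-- the total weight, and in an ended position the total is r.  The first move
-- creates the cyclic word iᵃ w jᵇ w with a, b ≥ 2, of weight only 4, and the first
-- move that later affects this word brings the total to 6: cutting it yields two
-- words of total weight 6, merging it with a component having at least two tips
-- yields weight 6, and merging it with a single tip yields weight 4 while the
-- other regions, which the single tip shows to exist, weigh at least 2.
module Submission where

open import Algebra.Properties.CommutativeSemigroup using (x∙yz≈y∙xz)
open import Data.Empty using (⊥-elim)
open import Data.Fin using (Fin; zero; suc; toℕ; fromℕ; inject₁)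
open import Data.Fin.Properties using (toℕ<n; toℕ-injective; toℕ-inject₁; toℕ-fromℕ)
open import Data.List using (sum; tabulate)
open import Data.List using (List; []; _∷_; [_]; _++_; _∷ʳ_; length; lookup; map; replicate)
open import Data.List.Membership.Propositional using (_∈_; find)
open import Data.List.Membership.Propositional.Properties using (∈-++⁺ˡ; ∈-++⁺ʳ; ∈-++⁻; ∈-∃++)
open import Data.List.Properties
  using (++-assoc; ++-identityʳ; ∷-injective; length-++; length-replicate; length-tabulate; map-++; map-tabulate; tabulate-cong)
open import Data.List.Relation.Binary.Permutation.Propositional
  using (_↭_; refl; prep; swap; ↭-reflexive; ↭-sym; ↭-trans; ↭⇒↭ₛ) renaming (trans to transitive)
open import Data.List.Relation.Binary.Permutation.Propositional.Properties
  using (∈-resp-↭; All-resp-↭; Any-resp-↭; drop-∷; shift; map⁺; ++-comm; ∷↭∷ʳ; ↭-length; ↭-empty-inv; ¬x∷xs↭[])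
import Data.List.Relation.Binary.Permutation.Setoid.Properties as Permutationₛ
open import Data.List.Relation.Unary.All as All using (All; []; _∷_; all?)
import Data.List.Relation.Unary.All.Properties as Allₚ
open Allₚ using (¬All⇒Any¬; ++⁻ˡ; ++⁻ʳ)
open import Data.List.Relation.Unary.AllPairs as AllPairs using (AllPairs; []; _∷_)
import Data.List.Relation.Unary.AllPairs.Properties as AllPairsₚ
open import Data.List.Relation.Unary.Any using (Any; here; there)
import Data.List.Relation.Unary.Any.Properties as Anyₚ
open import Data.Nat using (ℕ; zero; suc; _+_; _∸_; _≤_; _<_; z≤n; s≤s)
open import Data.Nat.ListAction using () renaming (sum to ∑)
open import Data.Nat.ListAction.Properties using (sum-↭; sum-++)
open import Data.Nat.Properties
open import Data.Nat.Solver using (module +-*-Solver)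
open import Data.Product using (_×_; _,_; ∃-syntax; proj₁; proj₂)
open import Data.Sum using (_⊎_; inj₁; inj₂; [_,_]′) renaming (swap to swap-⊎)
open import Relation.Binary.PropositionalEquality
  using (_≡_; _≢_; refl; sym; trans; cong; cong₂; subst; subst₂; ≢-sym; setoid; module ≡-Reasoning)
open import Relation.Nullary using (¬_; yes; no)
open import Defs

-- Girth and legal pairs

Edges : Set
Edges = List (ℕ × ℕ)

-- A record rather than a synonym for `Joins`, so that the index and the two ends can be inferred
-- from the type of a proof.
record EdgeAt (E : Edges) (e : Fin (length E)) (a b : ℕ) : Set where
  constructor ends
  field joined : Joins (lookup E e) a b

Adj : Edges → ℕ → ℕ → Set
Adj E a b = ∃[ e ] EdgeAt E e a b

-- By `girth⇒Legal` and `Legal⇒girth`, these are exactly the pairs whose joining keeps the girth at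
-- least 4.
Legal : Edges → ℕ → ℕ → Set
Legal E a b = a ≢ b × ¬ Adj E a b

Bounded : ℕ → Edges → Set
Bounded m E = ∀ {a b} → Adj E a b → a < m

-- The edges after joining a tip of u to a tip of v, with crossbar w.
sprout : ℕ → ℕ → ℕ → Edges → Edges
sprout w u v E = (u , w) ∷ (w , v) ∷ E

flip : ∀ {E e a b} → EdgeAt E e a b → EdgeAt E e b a
flip (ends j) = ends (swap-⊎ j)

Adj-sym : ∀ {E a b} → Adj E a b → Adj E b a
Adj-sym (e , j) = e , flip j

Legal-sym : ∀ {E a b} → Legal E a b → Legal E b a
Legal-sym (a≢b , ¬ab) = ≢-sym a≢b , λ ab → ¬ab (Adj-sym ab)

-- The three kinds of cycle shorter than 4, freed from the `Fin`-indexed encoding; the edges are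
-- still oriented along the cycle.
record Girth≥4 (E : Edges) : Set where
  field
    no-loop     : ∀ {e a} → ¬ EdgeAt E e a a
    no-parallel : ∀ {e f a b} → a ≢ b → e ≢ f → EdgeAt E e a b → ¬ EdgeAt E f b a
    no-triangle : ∀ {e f g a b c} → a ≢ b → b ≢ c → c ≢ a →
                  EdgeAt E e a b → EdgeAt E f b c → ¬ EdgeAt E g c a
open Girth≥4

private
  4≰1 : ¬ 4 ≤ 1
  4≰1 (s≤s ())
  4≰2 : ¬ 4 ≤ 2
  4≰2 (s≤s (s≤s ()))
  4≰3 : ¬ 4 ≤ 3
  4≰3 (s≤s (s≤s (s≤s ())))

girth⇒Girth≥4 : ∀ {m E} → GirthAtLeast 4 (mkGraph m E) → Girth≥4 E
girth⇒Girth≥4 {m} {E} girth = record { no-loop = loop ; no-parallel = parallel ; no-triangle = triangle }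
  where
  same-ends : ∀ {p a b c d} → Joins p a b → Joins p c d → (a ≡ c × b ≡ d) ⊎ (a ≡ d × b ≡ c)
  same-ends (inj₁ refl) (inj₁ refl) = inj₁ (refl , refl)
  same-ends (inj₁ refl) (inj₂ refl) = inj₂ (refl , refl)
  same-ends (inj₂ refl) (inj₁ refl) = inj₂ (refl , refl)
  same-ends (inj₂ refl) (inj₂ refl) = inj₁ (refl , refl)

  -- An edge has only two ends, so distinctness of the edges of a triangle follows from distinctness
  -- of its vertices.
  consecutive : ∀ {e f a b c} → b ≢ c → c ≢ a → EdgeAt E e a b → EdgeAt E f b c → e ≢ f
  consecutive b≢c c≢a (ends je) (ends jf) refl with same-ends je jf
  ... | inj₁ (_ , b≡c) = b≢c b≡c
  ... | inj₂ (a≡c , _) = c≢a (sym a≡c)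

  loop : ∀ {e a} → ¬ EdgeAt E e a a
  loop {e} {a} (ends j) = 4≰1 (girth 0 record
    { vertex = λ _ → a ; edge = λ _ → e
    ; vertex-distinct = λ { {zero} {zero} _ → refl } ; edge-distinct = λ { {zero} {zero} _ → refl }
    ; joins = λ { zero → j } })

  parallel : ∀ {e f a b} → a ≢ b → e ≢ f → EdgeAt E e a b → ¬ EdgeAt E f b a
  parallel {e} {f} {a} {b} a≢b e≢f (ends je) (ends jf) = 4≰2 (girth 1 record
    { vertex = pick a b ; edge = pick e f
    ; vertex-distinct = pick-inj a≢b ; edge-distinct = pick-inj e≢f
    ; joins = λ { zero → je ; (suc zero) → jf } })
    where
    pick : ∀ {A : Set} → A → A → Fin 2 → A
    pick x y zero = x
    pick x y (suc zero) = y
    pick-inj : ∀ {A : Set} {x y : A} → x ≢ y → ∀ {i j} → pick x y i ≡ pick x y j → i ≡ j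
    pick-inj ne {zero} {zero} _ = refl
    pick-inj ne {zero} {suc zero} eq = ⊥-elim (ne eq)
    pick-inj ne {suc zero} {zero} eq = ⊥-elim (ne (sym eq))
    pick-inj ne {suc zero} {suc zero} _ = refl

  triangle : ∀ {e f g a b c} → a ≢ b → b ≢ c → c ≢ a →
             EdgeAt E e a b → EdgeAt E f b c → ¬ EdgeAt E g c a
  triangle {e} {f} {g} {a} {b} {c} a≢b b≢c c≢a j₁@(ends je) j₂@(ends jf) j₃@(ends jg) = 4≰3 (girth 2 record
    { vertex = pick a b c ; edge = pick e f g
    ; vertex-distinct = pick-inj a≢b b≢c c≢a
    ; edge-distinct = pick-inj (consecutive b≢c c≢a j₁ j₂) (consecutive c≢a a≢b j₂ j₃)
                               (consecutive a≢b b≢c j₃ j₁)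
    ; joins = λ { zero → je ; (suc zero) → jf ; (suc (suc zero)) → jg } })
    where
    pick : ∀ {A : Set} → A → A → A → Fin 3 → A
    pick x y z zero = x
    pick x y z (suc zero) = y
    pick x y z (suc (suc zero)) = z
    pick-inj : ∀ {A : Set} {x y z : A} → x ≢ y → y ≢ z → z ≢ x →
               ∀ {i j} → pick x y z i ≡ pick x y z j → i ≡ j
    pick-inj p q r {zero} {zero} _ = refl
    pick-inj p q r {zero} {suc zero} eq = ⊥-elim (p eq)
    pick-inj p q r {zero} {suc (suc zero)} eq = ⊥-elim (r (sym eq))
    pick-inj p q r {suc zero} {zero} eq = ⊥-elim (p (sym eq))
    pick-inj p q r {suc zero} {suc zero} _ = refl
    pick-inj p q r {suc zero} {suc (suc zero)} eq = ⊥-elim (q eq)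
    pick-inj p q r {suc (suc zero)} {zero} eq = ⊥-elim (r eq)
    pick-inj p q r {suc (suc zero)} {suc zero} eq = ⊥-elim (q (sym eq))
    pick-inj p q r {suc (suc zero)} {suc (suc zero)} _ = refl

Girth≥4⇒girth : ∀ {m E} → Girth≥4 E → GirthAtLeast 4 (mkGraph m E)
Girth≥4⇒girth E≥4 0 C = ⊥-elim (no-loop E≥4 (ends (joins zero)))
  where open Cycle C
Girth≥4⇒girth E≥4 1 C = ⊥-elim (no-parallel E≥4
    (λ eq → 0≢1 (vertex-distinct eq)) (λ eq → 0≢1 (edge-distinct eq))
    (ends (joins zero)) (ends (joins (suc zero))))
  where
  open Cycle C
  0≢1 : _≢_ {A = Fin 2} zero (suc zero)
  0≢1 ()
Girth≥4⇒girth E≥4 2 C = ⊥-elim (no-triangle E≥4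
    (λ eq → 0≢1 (vertex-distinct eq)) (λ eq → 1≢2 (vertex-distinct eq)) (λ eq → 2≢0 (vertex-distinct eq))
    (ends (joins zero)) (ends (joins (suc zero))) (ends (joins (suc (suc zero)))))
  where
  open Cycle C
  0≢1 : _≢_ {A = Fin 3} zero (suc zero)
  0≢1 ()
  1≢2 : _≢_ {A = Fin 3} (suc zero) (suc (suc zero))
  1≢2 ()
  2≢0 : _≢_ {A = Fin 3} (suc (suc zero)) zero
  2≢0 ()
Girth≥4⇒girth E≥4 (suc (suc (suc k))) C = s≤s (s≤s (s≤s (s≤s z≤n)))

module Sprout {w u v : ℕ} {E : Edges} (bounded : Bounded w E) (u<w : u < w) (v<w : v < w) where

  private
    E′ = sprout w u v E
    u≢w = <⇒≢ u<w
    v≢w = <⇒≢ v<w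

  -- No old edge meets `w`, by `bounded`; hence only the two new edges do.
  at-w : ∀ e {a} → EdgeAt E′ e w a → (e ≡ zero × a ≡ u) ⊎ (e ≡ suc zero × a ≡ v)
  at-w zero (ends (inj₁ refl)) = ⊥-elim (u≢w refl)
  at-w zero (ends (inj₂ refl)) = inj₁ (refl , refl)
  at-w (suc zero) (ends (inj₁ refl)) = inj₂ (refl , refl)
  at-w (suc zero) (ends (inj₂ refl)) = ⊥-elim (v≢w refl)
  at-w (suc (suc e)) (ends j) = ⊥-elim (<⇒≢ (bounded (e , ends j)) refl)

  off-w : ∀ e {a b} → a ≢ w → b ≢ w → EdgeAt E′ e a b →
          ∃[ f ] (e ≡ suc (suc f) × EdgeAt E f a b)
  off-w zero a≢w b≢w (ends (inj₁ refl)) = ⊥-elim (b≢w refl)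
  off-w zero a≢w b≢w (ends (inj₂ refl)) = ⊥-elim (a≢w refl)
  off-w (suc zero) a≢w b≢w (ends (inj₁ refl)) = ⊥-elim (a≢w refl)
  off-w (suc zero) a≢w b≢w (ends (inj₂ refl)) = ⊥-elim (b≢w refl)
  off-w (suc (suc e)) a≢w b≢w (ends j) = e , refl , ends j

  sprout-bounded : Bounded (suc w) E′
  sprout-bounded (zero , ends (inj₁ refl)) = m≤n⇒m≤1+n u<w
  sprout-bounded (zero , ends (inj₂ refl)) = ≤-refl
  sprout-bounded (suc zero , ends (inj₁ refl)) = ≤-refl
  sprout-bounded (suc zero , ends (inj₂ refl)) = m≤n⇒m≤1+n v<w
  sprout-bounded (suc (suc e) , ends j) = m≤n⇒m≤1+n (bounded (e , ends j))

  Adj-w : ∀ {a} → Adj E′ a w → a ≡ u ⊎ a ≡ v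
  Adj-w (e , j) with at-w e (flip j)
  ... | inj₁ (_ , a≡u) = inj₁ a≡u
  ... | inj₂ (_ , a≡v) = inj₂ a≡v

  Legal-w : ∀ {a} → a < w → a ≢ u → a ≢ v → Legal E′ a w
  Legal-w a<w a≢u a≢v = <⇒≢ a<w , λ aw → [ a≢u , a≢v ]′ (Adj-w aw)

  Legal-lift : ∀ {a b} → a < w → b < w → Legal E a b → Legal E′ a b
  Legal-lift a<w b<w (a≢b , ¬ab) = a≢b , λ { (e , j) →
    let (f , _ , j′) = off-w e (<⇒≢ a<w) (<⇒≢ b<w) j in ¬ab (f , j′) }

  Legal-lower : ∀ {a b} → Legal E′ a b → Legal E a b
  Legal-lower (a≢b , ¬ab) = a≢b , λ { (e , ends j) → ¬ab (suc (suc e) , ends j) }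

  -- Equal ends would make the two new edges parallel, and an old edge between the ends would close
  -- a triangle with them.
  girth⇒Legal : Girth≥4 E′ → Legal E u v
  girth⇒Legal g = u≢v , λ { (e , ends j) →
      no-triangle g {e = zero} {f = suc zero} {g = suc (suc e)} u≢w (≢-sym v≢w) (≢-sym u≢v) (ends (inj₁ refl)) (ends (inj₁ refl))
        (flip (ends j)) }
    where
    u≢v : u ≢ v
    u≢v refl = no-parallel g {e = zero} {f = suc zero} u≢w (λ ()) (ends (inj₁ refl)) (ends (inj₁ refl))

  -- A short cycle avoiding `w` already lies in `E`. One through `w` uses both new edges, so a cycle
  -- of length 2 forces `u ≡ v` and a triangle forces an old edge between `u` and `v`.
  Legal⇒girth : Girth≥4 E → Legal E u v → Girth≥4 E′
  Legal⇒girth g (u≢v , ¬uv) = record { no-loop = loop ; no-parallel = parallel ; no-triangle = triangle }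
    where
    loop : ∀ {e a} → ¬ EdgeAt E′ e a a
    loop {e} {a} j with a ≟ w
    ... | yes refl = [ (λ (_ , w≡u) → u≢w (sym w≡u)) , (λ (_ , w≡v) → v≢w (sym w≡v)) ]′ (at-w e j)
    ... | no a≢w = let (_ , _ , j′) = off-w e a≢w a≢w j in no-loop g j′

    parallel-w : ∀ {e f b} → e ≢ f → EdgeAt E′ e w b → ¬ EdgeAt E′ f w b
    parallel-w {e} {f} e≢f je jf with at-w e je | at-w f jf
    ... | inj₁ (refl , _)    | inj₁ (refl , _)   = e≢f refl
    ... | inj₁ (_ , b≡u)     | inj₂ (_ , b≡v)    = u≢v (trans (sym b≡u) b≡v)
    ... | inj₂ (_ , b≡v)     | inj₁ (_ , b≡u)    = u≢v (trans (sym b≡u) b≡v)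
    ... | inj₂ (refl , _)    | inj₂ (refl , _)   = e≢f refl

    parallel : ∀ {e f a b} → a ≢ b → e ≢ f → EdgeAt E′ e a b → ¬ EdgeAt E′ f b a
    parallel {e} {f} {a} {b} a≢b e≢f je jf with a ≟ w | b ≟ w
    ... | yes refl | _ = parallel-w e≢f je (flip jf)
    ... | no _ | yes refl = parallel-w e≢f (flip je) jf
    ... | no a≢w | no b≢w =
      let (_ , e≡ , je′) = off-w e a≢w b≢w je
          (_ , f≡ , jf′) = off-w f b≢w a≢w jf
      in no-parallel g a≢b (λ eq → e≢f (trans e≡ (trans (cong (λ i → suc (suc i)) eq) (sym f≡)))) je′ jf′

    triangle-w : ∀ {e f h b c} → b ≢ c → b ≢ w → c ≢ w →
                 EdgeAt E′ e w b → EdgeAt E′ f b c → ¬ EdgeAt E′ h c w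
    triangle-w {e} {f} {h} {b} {c} b≢c b≢w c≢w je jf jh
      with off-w f b≢w c≢w jf | at-w e je | at-w h (flip jh)
    ... | _ , _ , _ | inj₁ (_ , refl) | inj₁ (_ , refl) = b≢c refl
    ... | i , _ , j | inj₁ (_ , refl) | inj₂ (_ , refl) = ¬uv (i , j)
    ... | i , _ , j | inj₂ (_ , refl) | inj₁ (_ , refl) = ¬uv (i , flip j)
    ... | _ , _ , _ | inj₂ (_ , refl) | inj₂ (_ , refl) = b≢c refl

    triangle : ∀ {e f h a b c} → a ≢ b → b ≢ c → c ≢ a →
               EdgeAt E′ e a b → EdgeAt E′ f b c → ¬ EdgeAt E′ h c a
    triangle {e} {f} {h} {a} {b} {c} a≢b b≢c c≢a je jf jh with a ≟ w | b ≟ w | c ≟ w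
    -- The triangle is turned so that `w` comes first.
    ... | yes refl | _ | _ = triangle-w b≢c (≢-sym a≢b) c≢a je jf jh
    ... | no a≢w | yes refl | _ = triangle-w c≢a (≢-sym b≢c) a≢w jf jh je
    ... | no a≢w | no b≢w | yes refl = triangle-w a≢b a≢w b≢w jh je jf
    ... | no a≢w | no b≢w | no c≢w =
      let (_ , _ , je′) = off-w e a≢w b≢w je
          (_ , _ , jf′) = off-w f b≢w c≢w jf
          (_ , _ , jh′) = off-w h c≢w a≢w jh
      in no-triangle g a≢b b≢c c≢a je′ jf′ jh′

-- Cyclic words

↻⇒↭ : ∀ {b c} → b ↻ c → b ↭ c
↻⇒↭ (rotate as bs) = ++-comm as bs

∈-↻ : ∀ {x b c} → b ↻ c → x ∈ b → x ∈ c
∈-↻ r = ∈-resp-↭ (↻⇒↭ r)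

∈-↻⁻ : ∀ {x b c} → b ↻ c → x ∈ c → x ∈ b
∈-↻⁻ r = ∈-resp-↭ (↭-sym (↻⇒↭ r))

δ : ℕ → ℕ → ℕ
δ a b with a ≟ b
... | yes _ = 0
... | no _ = 1

changes : List ℕ → ℕ
changes [] = 0
changes (x ∷ []) = 0
changes (x ∷ y ∷ l) = δ x y + changes (y ∷ l)

-- Repeating the first letter at the end makes the linear count include the change across the
-- wrap-around.
cyc : Boundary → ℕ
cyc [] = 0
cyc (x ∷ xs) = changes (x ∷ xs ++ [ x ])

δ-≢ : ∀ {a b} → a ≢ b → δ a b ≡ 1
δ-≢ {a} {b} a≢b with a ≟ b
... | yes a≡b = ⊥-elim (a≢b a≡b)
... | no _ = refl

δ-refl : ∀ a → δ a a ≡ 0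
δ-refl a with a ≟ a
... | yes _ = refl
... | no a≢a = ⊥-elim (a≢a refl)

δ≤1 : ∀ a b → δ a b ≤ 1
δ≤1 a b with a ≟ b
... | yes _ = z≤n
... | no _ = ≤-refl

δ≡0 : ∀ {a b} → δ a b ≡ 0 → a ≡ b
δ≡0 {a} {b} eq with a ≟ b
... | yes a≡b = a≡b
δ≡0 () | no _

changes-++ : ∀ xs {y ys} → changes (xs ++ y ∷ ys) ≡ changes (xs ++ [ y ]) + changes (y ∷ ys)
changes-++ [] = refl
changes-++ (x ∷ []) {y} {ys} = cong (_+ changes (y ∷ ys)) (sym (+-identityʳ (δ x y)))
changes-++ (x ∷ x′ ∷ xs) {y} {ys} =
  trans (cong (δ x x′ +_) (changes-++ (x′ ∷ xs))) (sym (+-assoc (δ x x′) _ _))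

changes-∷≤ : ∀ u xs → changes (u ∷ xs) ≤ 1 + changes xs
changes-∷≤ u [] = z≤n
changes-∷≤ u (x ∷ xs) = +-monoˡ-≤ _ (δ≤1 u x)

changes-∷ʳ≤ : ∀ xs v → changes (xs ++ [ v ]) ≤ 1 + changes xs
changes-∷ʳ≤ [] v = z≤n
changes-∷ʳ≤ (x ∷ []) v = +-monoˡ-≤ 0 (δ≤1 x v)
changes-∷ʳ≤ (x ∷ y ∷ l) v = begin
  δ x y + changes (y ∷ l ++ [ v ])  ≤⟨ +-monoʳ-≤ (δ x y) (changes-∷ʳ≤ (y ∷ l) v) ⟩
  δ x y + suc (changes (y ∷ l))     ≡⟨ +-suc (δ x y) _ ⟩
  suc (δ x y + changes (y ∷ l))     ∎
  where open ≤-Reasoning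

changes-∷ʳ : ∀ {w} x xs → All (_< w) (x ∷ xs) → changes (x ∷ xs ++ [ w ]) ≡ 1 + changes (x ∷ xs)
changes-∷ʳ {w} x [] (x<w ∷ _) = trans (+-identityʳ _) (δ-≢ (<⇒≢ x<w))
changes-∷ʳ x (y ∷ l) (_ ∷ l<w) = trans (cong (δ x y +_) (changes-∷ʳ y l l<w)) (+-suc (δ x y) _)

enclosed≤ : ∀ u xs v → changes (u ∷ xs ++ [ v ]) ≤ 2 + changes xs
enclosed≤ u xs v = ≤-trans (changes-∷≤ u (xs ++ [ v ])) (s≤s (changes-∷ʳ≤ xs v))

-- The fresh letter differs from both of its neighbours. Together with `enclosed≤` this shows that
-- replacing what encloses a nonempty segment by a fresh letter never loses a change.
cyc-∷-fresh : ∀ {w x xs} → All (_< w) (x ∷ xs) → cyc (w ∷ x ∷ xs) ≡ 2 + changes (x ∷ xs)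
cyc-∷-fresh {w} {x} {xs} (x<w ∷ xs<w) = cong₂ _+_ (δ-≢ (>⇒≢ x<w)) (changes-∷ʳ x xs (x<w ∷ xs<w))

changes≡0 : ∀ {x} l → changes (x ∷ l) ≡ 0 → All (_≡ x) l
changes≡0 [] _ = []
changes≡0 {x} (y ∷ l) eq with δ≡0 {x} {y} (m+n≡0⇒m≡0 (δ x y) eq)
... | refl = refl ∷ changes≡0 l (m+n≡0⇒n≡0 (δ x x) eq)

changes-distinct : ∀ {a b l} → a ∈ l → b ∈ l → a ≢ b → 1 ≤ changes l
changes-distinct {a} {b} {x ∷ l} a∈ b∈ a≢b with changes (x ∷ l) in eq
... | suc _ = s≤s z≤n
... | 0 = ⊥-elim (a≢b (trans (≡x a∈) (sym (≡x b∈))))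
  where
  ≡x : ∀ {c} → c ∈ x ∷ l → c ≡ x
  ≡x (here c≡x) = c≡x
  ≡x (there c∈) = All.lookup (changes≡0 l eq) c∈

changes-constantˡ : ∀ {u xs} v → All (_≡ u) xs → changes (u ∷ xs ++ [ v ]) ≤ 1
changes-constantˡ {u} v [] = ≤-trans (≤-reflexive (+-identityʳ _)) (δ≤1 u v)
changes-constantˡ {u} {_ ∷ xs} v (refl ∷ p) =
  subst (λ k → k + changes (u ∷ xs ++ [ v ]) ≤ 1) (sym (δ-refl u)) (changes-constantˡ v p)

changes-constantʳ : ∀ {xs v} u → All (_≡ v) xs → changes (u ∷ xs ++ [ v ]) ≤ 1
changes-constantʳ {v = v} u [] = changes-constantˡ v []
changes-constantʳ {v ∷ xs} u (refl ∷ p) =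
  subst (λ k → δ u v + k ≤ 1) (sym (constant p)) (≤-trans (≤-reflexive (+-identityʳ _)) (δ≤1 u v))
  where
  constant : ∀ {l} → All (_≡ v) l → changes (v ∷ l ++ [ v ]) ≡ 0
  constant [] = cong (_+ 0) (δ-refl v)
  constant (refl ∷ q) = cong₂ _+_ (δ-refl v) (constant q)

-- The letters `u` and `v` cut the cycle into two arcs; each of them ends both arcs, so no adjacency
-- is lost or counted twice.
cyc-split : ∀ u xs v ys → cyc (u ∷ xs ++ v ∷ ys) ≡ changes (u ∷ xs ++ [ v ]) + changes (v ∷ ys ++ [ u ])
cyc-split u xs v ys = trans (cong changes (++-assoc (u ∷ xs) (v ∷ ys) [ u ])) (changes-++ (u ∷ xs))

cyc-↻ : ∀ {b c} → b ↻ c → cyc b ≡ cyc c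
cyc-↻ (rotate [] bs) = cong cyc (sym (++-identityʳ bs))
cyc-↻ (rotate (a ∷ as) []) = cong cyc (++-identityʳ (a ∷ as))
cyc-↻ (rotate (a ∷ as) (b ∷ bs)) =
  trans (cyc-split a as b bs) (trans (+-comm (changes (a ∷ as ++ [ b ])) _) (sym (cyc-split b bs a as)))

↻-∷ : ∀ w xs → (w ∷ xs) ↻ (xs ++ [ w ])
↻-∷ w xs = rotate [ w ] xs

↻-merge : ∀ w xs ys → (xs ++ [ w ] ++ ys ++ [ w ]) ↻ (ys ++ [ w ] ++ xs ++ [ w ])
↻-merge w xs ys = subst (_↻ (ys ++ w ∷ xs ++ [ w ])) (++-assoc xs [ w ] (ys ++ [ w ]))
  (subst (((xs ++ [ w ]) ++ ys ++ [ w ]) ↻_) (++-assoc ys [ w ] (xs ++ [ w ])) (rotate (xs ++ [ w ]) (ys ++ [ w ])))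

-- The two copies of `w` cut the merged word into two arcs, each of which closes up to a cyclic word
-- through a single `w`.
cyc-merge : ∀ w xs ys → cyc (xs ++ [ w ] ++ ys ++ [ w ]) ≡ cyc (w ∷ xs) + cyc (w ∷ ys)
cyc-merge w xs ys = begin
  cyc (xs ++ [ w ] ++ ys ++ [ w ])     ≡⟨ cong cyc (++-assoc xs (w ∷ ys) [ w ]) ⟨
  cyc ((xs ++ w ∷ ys) ++ [ w ])        ≡⟨ cyc-↻ (rotate [ w ] (xs ++ w ∷ ys)) ⟨
  cyc (w ∷ xs ++ w ∷ ys)               ≡⟨ cyc-split w xs w ys ⟩
  cyc (w ∷ xs) + cyc (w ∷ ys)          ∎
  where open ≡-Reasoning

-- Legal pairs on a frontier component, and what cutting or merging preserves

HasLegal : Edges → Boundary → Set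
HasLegal E b = ∃[ x ] ∃[ y ] (x ∈ b × y ∈ b × Legal E x y)

HasLegal-⊆ : ∀ {E b c} → (∀ {x} → x ∈ b → x ∈ c) → HasLegal E b → HasLegal E c
HasLegal-⊆ b⊆c (x , y , x∈ , y∈ , xy) = x , y , b⊆c x∈ , b⊆c y∈ , xy

-- The changes count only if b has a legal pair: a terminal word u … u w has two
-- cyclic changes but ends up in a single region.
Worth : Edges → Boundary → ℕ → Set
Worth E b m = m ≤ 1 ⊎ HasLegal E b × m ≤ cyc b

Worth-↻ : ∀ {E b c m} → b ↻ c → Worth E b m → Worth E c m
Worth-↻ r (inj₁ m≤1) = inj₁ m≤1
Worth-↻ r (inj₂ (h , m≤)) = inj₂ (HasLegal-⊆ (∈-↻ r) h , ≤-trans m≤ (≤-reflexive (cyc-↻ r)))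

HasLegal⇒≢ : ∀ {E b} u → HasLegal E b → ∃[ z ] (z ∈ b × z ≢ u)
HasLegal⇒≢ u (x , y , x∈ , y∈ , x≢y , _) with x ≟ u
... | no x≢u = x , x∈ , x≢u
... | yes refl = y , y∈ , ≢-sym x≢y

module SproutWorth {w u v : ℕ} {E : Edges} (bounded : Bounded w E) (u<w : u < w) (v<w : v < w)
                   (uv : Legal E u v) where

  open Sprout {E = E} bounded u<w v<w

  private E′ = sprout w u v E

  HasLegal-lift : ∀ {b} → All (_< w) b → HasLegal E b → HasLegal E′ b
  HasLegal-lift b<w (x , y , x∈ , y∈ , xy) =
    x , y , x∈ , y∈ , Legal-lift (All.lookup b<w x∈) (All.lookup b<w y∈) xy

  -- Instantiated with (p, q) = (u, v) and (v, u): the two sides of the curve.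
  module Side {p q : ℕ} (pq : Legal E′ p q)
              (Legal-pq : ∀ {z} → z < w → z ≢ p → z ≢ q → Legal E′ z w) where

    HasLegal-w : ∀ {b z} → w ∈ b → z ∈ b → z < w → z ≢ p → z ≢ q → HasLegal E′ b
    HasLegal-w w∈ z∈ z<w z≢p z≢q = _ , _ , z∈ , w∈ , Legal-pq z<w z≢p z≢q

    -- Take letters `a` other than `p` and `c` other than `q`. If one of them avoids both ends, it
    -- is legal with `w`; otherwise they are `q` and `p` themselves, a legal pair.
    cut-HasLegal : ∀ {xs} → All (_< w) xs → ¬ All (_≡ p) xs → ¬ All (_≡ q) xs → HasLegal E′ (w ∷ xs)
    cut-HasLegal {xs} xs<w ¬p ¬q
      with find (¬All⇒Any¬ (_≟ p) xs ¬p) | find (¬All⇒Any¬ (_≟ q) xs ¬q)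
    ... | a , a∈ , a≢p | c , c∈ , c≢q with a ≟ q | c ≟ p
    ... | no a≢q | _ = HasLegal-w (here refl) (there a∈) (All.lookup xs<w a∈) a≢p a≢q
    ... | yes _ | no c≢p = HasLegal-w (here refl) (there c∈) (All.lookup xs<w c∈) c≢p c≢q
    ... | yes refl | yes refl = c , a , there c∈ , there a∈ , pq

    -- If all remaining tips on this side come from a single endpoint, the piece may be
    -- terminal; but then the segment it replaces contains at most one change.
    cut-worth : ∀ {m xs} → All (_< w) xs → m ≤ changes (p ∷ xs ++ [ q ]) → Worth E′ (w ∷ xs) m
    cut-worth {m} {xs} xs<w m≤ with all? (_≟ p) xs | all? (_≟ q) xs
    ... | yes xs≡p | _ = inj₁ (≤-trans m≤ (changes-constantˡ q xs≡p))
    ... | no _ | yes xs≡q = inj₁ (≤-trans m≤ (changes-constantʳ p xs≡q))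
    cut-worth {xs = []} xs<w _ | no ¬p | no _ = ⊥-elim (¬p [])
    cut-worth {xs = x ∷ xs} xs<w m≤ | no ¬p | no ¬q = inj₂ (cut-HasLegal xs<w ¬p ¬q ,
      ≤-trans m≤ (≤-trans (enclosed≤ p (x ∷ xs) q) (≤-reflexive (sym (cyc-∷-fresh xs<w)))))

    -- A legal pair contains a letter other than `p`. It also differs from `q`, since `q` does not
    -- occur in `b`, so it is legal with the new vertex.
    merge-HasLegal : ∀ {b xs} ys → b ↻ (p ∷ xs) → All (_< w) xs → (∀ {z} → z ∈ b → z ≢ q) →
                     HasLegal E b → HasLegal E′ (xs ++ [ w ] ++ ys ++ [ w ])
    merge-HasLegal {xs = xs} ys r xs<w ≢q h with HasLegal⇒≢ p h
    ... | z , z∈ , z≢p with ∈-↻ r z∈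
    ... | here z≡p = ⊥-elim (z≢p z≡p)
    ... | there z∈xs = HasLegal-w (∈-++⁺ʳ xs (here refl)) (∈-++⁺ˡ z∈xs) (All.lookup xs<w z∈xs) z≢p (≢q z∈)

    -- The arc of the merged word coming from `b` suffices: it is `b` with the joined tip replaced
    -- by the fresh `w`, and the legal pair guarantees that something besides that tip is left.
    merge-worth : ∀ {b m xs} ys → b ↻ (p ∷ xs) → All (_< w) xs → (∀ {z} → z ∈ b → z ≢ q) →
                  Worth E b m → Worth E′ (xs ++ [ w ] ++ ys ++ [ w ]) m
    merge-worth ys r xs<w ≢q (inj₁ m≤1) = inj₁ m≤1
    merge-worth {b} {m} {xs} ys r xs<w ≢q (inj₂ (h , m≤)) = inj₂ (merge-HasLegal ys r xs<w ≢q h , (begin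
      m                                    ≤⟨ m≤ ⟩
      cyc b                                ≡⟨ cyc-↻ r ⟩
      cyc (p ∷ xs)                         ≤⟨ bound xs xs<w (HasLegal⇒≢ p (HasLegal-⊆ (∈-↻ r) h)) ⟩
      cyc (w ∷ xs)                         ≤⟨ m≤m+n _ _ ⟩
      cyc (w ∷ xs) + cyc (w ∷ ys)          ≡⟨ cyc-merge w xs ys ⟨
      cyc (xs ++ [ w ] ++ ys ++ [ w ])     ∎))
      where
      open ≤-Reasoning
      bound : ∀ xs → All (_< w) xs → ∃[ z ] (z ∈ p ∷ xs × z ≢ p) → cyc (p ∷ xs) ≤ cyc (w ∷ xs)
      bound [] _ (z , here z≡p , z≢p) = ⊥-elim (z≢p z≡p)
      bound (x ∷ xs) <w _ = ≤-trans (enclosed≤ p (x ∷ xs) p) (≤-reflexive (sym (cyc-∷-fresh <w)))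

  uv′ : Legal E′ u v
  uv′ = Legal-lift u<w v<w uv

  module Left = Side uv′ Legal-w
  module Right = Side (Legal-sym uv′) (λ z<w z≢v z≢u → Legal-w z<w z≢u z≢v)

-- Special words

record Split (u v : ℕ) (xs ys : Boundary) : Set where
  field
    -- For the word iᵃ w jᵇ w this is `w`, present on both sides of the cut. Being neither end of
    -- the curve, it is legal with the next crossbar vertex, so each piece may count its changes.
    {separator} : ℕ
    separator∈ˡ : separator ∈ xs
    separator∈ʳ : separator ∈ ys
    separator≢ˡ : separator ≢ u
    separator≢ʳ : separator ≢ v
    changes≥2   : 2 ≤ changes xs + changes ys

-- The properties of iᵃ w jᵇ w (a, b ≥ 2) that later moves rely on; the field split
-- says that every legal cut separates the two tips of w.
record Special (E : Edges) (b : Boundary) : Set where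
  field
    has-legal : HasLegal E b
    cyc≥4     : 4 ≤ cyc b
    split     : ∀ {u v xs ys} → b ↻ (u ∷ xs ++ v ∷ ys) → Legal E u v → Split u v xs ys

-- Levi's lemma with a marked letter.
locate : ∀ xs {v : ℕ} {ys} as {bs} → xs ++ v ∷ ys ≡ as ++ bs →
         (∃[ as₂ ] (as ≡ xs ++ v ∷ as₂ × ys ≡ as₂ ++ bs)) ⊎
         (∃[ bs₁ ] (xs ≡ as ++ bs₁ × bs ≡ bs₁ ++ v ∷ ys))
locate xs [] eq = inj₂ (xs , refl , sym eq)
locate [] (a ∷ as) refl = inj₁ (as , refl , refl)
locate (x ∷ xs) (a ∷ as) eq with ∷-injective eq
... | refl , eq′ with locate xs as eq′
...   | inj₁ (as₂ , refl , p) = inj₁ (as₂ , refl , p)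
...   | inj₂ (bs₁ , refl , p) = inj₂ (bs₁ , refl , p)

-- Levi's lemma on two factorisations of one word.
levi : ∀ (ps : List ℕ) {qs} as {bs} → ps ++ qs ≡ as ++ bs →
       (∃[ e ] (as ≡ ps ++ e × qs ≡ e ++ bs)) ⊎ (∃[ f ] (ps ≡ as ++ f × bs ≡ f ++ qs))
levi [] as eq = inj₁ (as , refl , eq)
levi (p ∷ ps) [] eq = inj₂ (p ∷ ps , refl , sym eq)
levi (p ∷ ps) (a ∷ as) eq with ∷-injective eq
... | refl , eq′ with levi ps as eq′
...   | inj₁ (e , refl , q) = inj₁ (e , refl , q)
...   | inj₂ (f , refl , q) = inj₂ (f , refl , q)

-- c is the word as w bs w, read cyclically from a place inside as.
CutIn : ℕ → List ℕ → List ℕ → List ℕ → Set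
CutIn w as bs c = ∃[ p ] ∃[ e ] (as ≡ p ++ e × c ≡ e ++ w ∷ bs ++ w ∷ p)

rotations : ∀ {w} as bs {c} → (as ++ [ w ] ++ bs ++ [ w ]) ↻ c → CutIn w as bs c ⊎ CutIn w bs as c
rotations {w} as bs r = go r refl
  where
  reassoc : ∀ (xs : List ℕ) ys zs → (xs ++ w ∷ ys ++ [ w ]) ++ zs ≡ xs ++ w ∷ ys ++ w ∷ zs
  reassoc xs ys zs = trans (++-assoc xs (w ∷ ys ++ [ w ]) zs) (cong (λ l → xs ++ w ∷ l) (++-assoc ys [ w ] zs))
  go : ∀ {b c} → b ↻ c → b ≡ as ++ [ w ] ++ bs ++ [ w ] → CutIn w as bs c ⊎ CutIn w bs as c
  go (rotate p q) eq with levi p as eq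
  ... | inj₁ (e , refl , refl) = inj₁ (p , e , refl , reassoc e bs p)
  ... | inj₂ ([] , refl , refl) = inj₁ (as , [] , sym (++-identityʳ as) ,
          trans (reassoc [] bs (as ++ [])) (cong (λ l → w ∷ bs ++ w ∷ l) (++-identityʳ as)))
  ... | inj₂ (x ∷ f , refl , eq₂) with ∷-injective eq₂
  ...   | refl , eq₃ with levi f bs (sym eq₃)
  ...     | inj₁ (e , refl , refl) = inj₂ (f , e , refl ,
              trans (++-assoc e [ w ] (as ++ w ∷ f)) refl)
  ...     | inj₂ ([] , refl , refl) = inj₂ (bs , [] , sym (++-identityʳ bs) ,
              cong (λ l → w ∷ as ++ w ∷ l) (++-identityʳ bs))
  -- Here the whole word precedes the point of rotation, so nothing changes; the clause at the end
  -- excludes any letter after the last `w`.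
  ...     | inj₂ (y ∷ [] , refl , eq₄) with ∷-injective eq₄
  ...       | refl , refl = inj₁ ([] , as , refl , refl)
  go (rotate p q) eq | inj₂ (x ∷ f , refl , eq₂) | refl , eq₃ | inj₂ (y ∷ y′ ∷ g , refl , ())

module Alternating {E : Edges} {w : ℕ} where

  -- Two equal letters are not legal, and neither is `w` with any letter, as both i and j are
  -- adjacent to it. So the cut joins an i to a j, and one copy of `w` falls on each side.
  cut-split : ∀ {i j as bs u v xs ys} → w ≢ i → w ≢ j → Adj E i w → Adj E j w →
              All (_≡ i) as → All (_≡ j) bs → 2 ≤ length as → 2 ≤ length bs →
              CutIn w as bs (u ∷ xs ++ v ∷ ys) → Legal E u v → Split u v xs ys
  cut-split {i} {j} {as} {bs} {u} {v} {xs} {ys} w≢i w≢j iw jw as≡i bs≡j 2≤as 2≤bs (p , [] , refl , eq) (u≢v , ¬uv)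
    with ∷-injective eq
  -- Here `u` is `w`, and every other letter is `w` or adjacent to it.
  ... | refl , eq′ with ∈-++⁻ bs (subst (v ∈_) eq′ (∈-++⁺ʳ xs (here refl)))
  ...   | inj₁ v∈ = ⊥-elim (¬uv (subst (Adj E w) (sym (All.lookup bs≡j v∈)) (Adj-sym jw)))
  ...   | inj₂ (here v≡w) = ⊥-elim (u≢v (sym v≡w))
  ...   | inj₂ (there v∈) = ⊥-elim (¬uv (subst (Adj E w) (sym (All.lookup as≡i (∈-++⁺ˡ v∈))) (Adj-sym iw)))
  cut-split {i} {j} {as} {bs} {u} {v} {xs} {ys} w≢i w≢j iw jw as≡i bs≡j 2≤as 2≤bs (p , k ∷ e , refl , eq) (u≢v , ¬uv)
    with ∷-injective eq | All.lookup as≡i (∈-++⁺ʳ p (here refl))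
  ... | refl , eq′ | refl with locate xs e eq′
  ...   | inj₁ (e₂ , refl , _) =
            ⊥-elim (u≢v (sym (All.lookup as≡i (∈-++⁺ʳ p (there (∈-++⁺ʳ xs (here refl)))))))
  ...   | inj₂ ([] , _ , refl) = ⊥-elim (¬uv iw)
  ...   | inj₂ (x ∷ q , refl , eq₂) with ∷-injective eq₂
  ...     | refl , eq₃ with locate q bs (sym eq₃)
  ...       | inj₂ ([] , _ , refl) = ⊥-elim (¬uv iw)
  ...       | inj₂ (x ∷ r , _ , eq₄) with ∷-injective eq₄
  ...         | refl , refl = ⊥-elim (u≢v (sym (All.lookup as≡i (∈-++⁺ˡ {xs = r ++ v ∷ ys} (∈-++⁺ʳ r (here refl))))))
  cut-split {i} {j} w≢i w≢j iw jw as≡i bs≡j 2≤as 2≤bs (p , k ∷ e , refl , eq) (u≢v , ¬uv)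
    | refl , eq′ | refl | inj₂ (x ∷ q , refl , eq₂) | refl , eq₃ | inj₁ (r , refl , refl)
    with All.lookup bs≡j (∈-++⁺ʳ q (here refl))
  ... | refl = record
    { separator∈ˡ = ∈-++⁺ʳ e (here refl)
    ; separator∈ʳ = ∈-++⁺ʳ r (here refl)
    ; separator≢ˡ = w≢i
    ; separator≢ʳ = w≢j
    ; changes≥2 = bound
        (more p (++⁻ˡ p as≡i) (All.tail (++⁻ʳ p as≡i)) w≢i 2≤as)
        (more q (++⁻ˡ q bs≡j) (All.tail (++⁻ʳ q bs≡j)) w≢j 2≤bs)
    }
    where
    before : ∀ {k l} → All (_≡ k) l → w ≢ k → 1 ≤ length l → 1 ≤ changes (l ++ [ w ])
    before {l = x ∷ l} (refl ∷ _) w≢k _ =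
      changes-distinct (∈-++⁺ʳ (x ∷ l) (here refl)) (here refl) w≢k
    after : ∀ {k l} → All (_≡ k) l → w ≢ k → 1 ≤ length l → 1 ≤ changes (w ∷ l)
    after {l = x ∷ l} (refl ∷ _) w≢k _ = changes-distinct {l = w ∷ x ∷ l} (here refl) (there (here refl)) w≢k
    -- A block of at least two letters keeps one after losing a tip, and that letter gives a change
    -- next to a copy of `w`. The two blocks together supply the two changes required.
    more : ∀ {k x} l {m} → All (_≡ k) l → All (_≡ k) m → w ≢ k → 2 ≤ length (l ++ x ∷ m) →
           1 ≤ changes (w ∷ l) ⊎ 1 ≤ changes (m ++ [ w ])
    more [] {m} l≡ m≡ w≢k (s≤s h) = inj₂ (before m≡ w≢k h)
    more (x ∷ l) l≡ m≡ w≢k _ = inj₁ (after l≡ w≢k (s≤s z≤n))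
    bound : 1 ≤ changes (w ∷ p) ⊎ 1 ≤ changes (e ++ [ w ]) →
            1 ≤ changes (w ∷ q) ⊎ 1 ≤ changes (r ++ [ w ]) →
            2 ≤ changes (e ++ w ∷ q) + changes (r ++ w ∷ p)
    bound h₁ h₂ rewrite changes-++ e {w} {q} | changes-++ r {w} {p} = add-up h₁ h₂
      where
      add-up : ∀ {a b c d} → 1 ≤ d ⊎ 1 ≤ a → 1 ≤ b ⊎ 1 ≤ c → 2 ≤ (a + b) + (c + d)
      add-up {a} {b} {c} {d} (inj₁ d≥) (inj₁ b≥) =
        +-mono-≤ (≤-trans b≥ (m≤n+m b a)) (≤-trans d≥ (m≤n+m d c))
      add-up {a} {b} {c} {d} (inj₁ d≥) (inj₂ c≥) =
        ≤-trans (+-mono-≤ c≥ d≥) (m≤n+m (c + d) (a + b))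
      add-up {a} {b} {c} {d} (inj₂ a≥) (inj₁ b≥) =
        ≤-trans (+-mono-≤ a≥ b≥) (m≤m+n (a + b) (c + d))
      add-up {a} {b} {c} {d} (inj₂ a≥) (inj₂ c≥) =
        +-mono-≤ (≤-trans a≥ (m≤m+n a b)) (≤-trans c≥ (m≤m+n c d))

  special : ∀ {i j as bs} → i < w → j < w → Adj E i w → Adj E j w → Legal E i j →
            All (_≡ i) as → All (_≡ j) bs → 2 ≤ length as → 2 ≤ length bs →
            Special E (as ++ [ w ] ++ bs ++ [ w ])
  special {as = a ∷ as} {b ∷ bs} i<w j<w iw jw ij a≡@(refl ∷ _) b≡@(refl ∷ _) 2≤as 2≤bs = record
    { has-legal = a , b , here refl , ∈-++⁺ʳ (a ∷ as) (there (here refl)) , ij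
    ; cyc≥4 = ≤-trans (+-mono-≤ (two a≡ i<w) (two b≡ j<w)) (≤-reflexive (sym (cyc-merge w (a ∷ as) (b ∷ bs))))
    -- The word is symmetric in its two blocks, so a cut starting in the second block is the first
    -- case with i and j exchanged.
    ; split = λ r uv → [ (λ cut → cut-split (>⇒≢ i<w) (>⇒≢ j<w) iw jw a≡ b≡ 2≤as 2≤bs cut uv)
                       , (λ cut → cut-split (>⇒≢ j<w) (>⇒≢ i<w) jw iw b≡ a≡ 2≤bs 2≤as cut uv) ]′
                       (rotations (a ∷ as) (b ∷ bs) r)
    }
    where
    two : ∀ {k x l} → All (_≡ k) (x ∷ l) → k < w → 2 ≤ cyc (w ∷ x ∷ l)
    two {x = x} {l} p k<w = ≤-trans (s≤s (s≤s z≤n))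
      (≤-reflexive (sym (cyc-∷-fresh {x = x} {l} (All.map (λ x≡k → subst (_< w) (sym x≡k) k<w) p))))

-- Regions and their weights

-- The trace, in terms of vertices and edges alone, of the fact that different frontier components
-- of a region lie on different connected components of the drawing.
record Separated (E : Edges) (b c : Boundary) : Set where
  constructor apart
  field legal : ∀ {x y} → x ∈ b → y ∈ c → Legal E x y
open Separated

Separated-sym : ∀ {E b c} → Separated E b c → Separated E c b
Separated-sym (apart bc) = apart (λ x∈c y∈b → Legal-sym (bc y∈b x∈c))

record Good (w : ℕ) (E : Edges) (X : Region) : Set where
  field
    nonempty  : 1 ≤ length X
    open-tips : All (λ b → 1 ≤ length b) X
    bounded   : All (All (_< w)) X
    separated : AllPairs (Separated E) X

Good-↭ : ∀ {w E X Y} → X ↭ Y → Good w E X → Good w E Y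
Good-↭ {E = E} π g = record
  { nonempty  = subst (1 ≤_) (↭-length π) nonempty
  ; open-tips = All-resp-↭ π open-tips
  ; bounded   = All-resp-↭ π bounded
  ; separated = Permutationₛ.AllPairs-resp-↭ (setoid Boundary)
      Separated-sym
      ((λ { refl s → s }) , (λ { refl s → s }))
      (↭⇒↭ₛ π) separated
  } where open Good g

WorthR : Edges → Region → ℕ → Set
WorthR E X m = m ≤ 1 ⊎ Any (λ b → Worth E b m) X

-- The index is a certified lower bound on the total weight; the weight itself, a maximum over the
-- components of each region, is never computed.
data Weight (E : Edges) : List Region → ℕ → Set where
  []  : Weight E [] 0
  add : ∀ {X Ss m k n} → WorthR E X m → Weight E Ss k → n ≤ m + k → Weight E (X ∷ Ss) n

Weight-length : ∀ {E} Rs {m} → m ≤ length Rs → Weight E Rs m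
Weight-length [] z≤n = []
Weight-length (X ∷ Rs) m≤ = add (inj₁ ≤-refl) (Weight-length Rs ≤-refl) m≤

Weight-↭ : ∀ {E Rs Rs′ m} → Rs ↭ Rs′ → Weight E Rs m → Weight E Rs′ m
Weight-↭ refl W = W
Weight-↭ (prep X π) (add V W m≤) = add V (Weight-↭ π W) m≤
Weight-↭ (swap X Y π) (add {m = m} {k} {n} V (add {m = m′} {k′} V′ W k≤) n≤) =
  add V′ (add V (Weight-↭ π W) ≤-refl) (begin
    n               ≤⟨ n≤ ⟩
    m + k           ≤⟨ +-monoʳ-≤ m k≤ ⟩
    m + (m′ + k′)   ≡⟨ x∙yz≈y∙xz +-commutativeSemigroup m m′ k′ ⟩
    m′ + (m + k′)   ∎)
  where
  open ≤-Reasoning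
Weight-↭ (transitive π ρ) W = Weight-↭ ρ (Weight-↭ π W)

∈⇒↭ : ∀ {A : Set} {x : A} {xs} → x ∈ xs → ∃[ ys ] (xs ↭ x ∷ ys)
∈⇒↭ x∈ with ∈-∃++ x∈
... | as , bs , refl = as ++ bs , shift _ as bs

-- Compares two choices of a distinguished element. It decides whether a move takes place in the
-- region holding the special word or in another one.
↭-∷-inv : ∀ {A : Set} {x y : A} {xs ys} → x ∷ xs ↭ y ∷ ys →
          (x ≡ y × xs ↭ ys) ⊎ ∃[ zs ] (xs ↭ y ∷ zs × ys ↭ x ∷ zs)
↭-∷-inv {x = x} {y} {xs} π with ∈-resp-↭ (↭-sym π) (here refl)
... | here refl = inj₁ (refl , drop-∷ π)
... | there y∈xs with ∈⇒↭ y∈xs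
... | zs , σ = inj₂ (zs , σ , drop-∷ (↭-trans (↭-sym π) (↭-trans (prep x σ) (swap x y refl))))

-- Stages of a play

Constant : Boundary → Set
Constant b = ∃[ i ] All (_≡ i) b

-- Ss are the other regions.  Merging a special word with a single tip yields weight
-- 4, two short of 6, so Ss must then weigh 2; the condition for Ss ≡ [] ensures this
-- when the first cut produces a single tip.
Sound : Edges → List Region → Boundary → Set
Sound E Ss b = (2 ≤ length b × (Ss ≡ [] → Constant b ⊎ 3 ≤ cyc b)) ⊎ Weight E Ss 2

-- `opening` is the position before the first move, `middle` lasts while the special word is
-- untouched, and `late` is permanent. The equation `x ≡ 0` serves to show that a play cannot end in
-- the opening.
data Stage (x : ℕ) (E : Edges) (Rs : List Region) : Set where
  opening : ∀ {X} → x ≡ 0 → Rs ≡ [ X ] → All (λ b → Constant b × 3 ≤ length b) X → Stage x E Rs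
  middle  : ∀ {X Ss} → Rs ↭ X ∷ Ss → Any (Special E) X → All (Sound E Ss) X → Stage x E Rs
  late    : Weight E Rs 6 → Stage x E Rs

1≤length-∷ʳ : ∀ xs (w : ℕ) → 1 ≤ length (xs ++ [ w ])
1≤length-∷ʳ [] w = s≤s z≤n
1≤length-∷ʳ (x ∷ xs) w = s≤s z≤n

∈-∷ʳ⁻ : ∀ {x w : ℕ} xs → x ∈ xs ++ [ w ] → x ≡ w ⊎ x ∈ xs
∈-∷ʳ⁻ xs x∈ with ∈-++⁻ xs x∈
... | inj₁ x∈xs = inj₂ x∈xs
... | inj₂ (here x≡w) = inj₁ x≡w

∈-merge⁻ : ∀ {x w : ℕ} xs ys → x ∈ xs ++ [ w ] ++ ys ++ [ w ] → x ≡ w ⊎ x ∈ xs ⊎ x ∈ ys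
∈-merge⁻ xs ys x∈ with ∈-++⁻ xs x∈
... | inj₁ x∈xs = inj₂ (inj₁ x∈xs)
... | inj₂ (here x≡w) = inj₁ x≡w
... | inj₂ (there x∈′) with ∈-∷ʳ⁻ ys x∈′
...   | inj₁ x≡w = inj₁ x≡w
...   | inj₂ x∈ys = inj₂ (inj₂ x∈ys)

2≤length-merge : ∀ (w : ℕ) xs ys → 2 ≤ length (xs ++ [ w ] ++ ys ++ [ w ])
2≤length-merge w [] ys = s≤s (1≤length-∷ʳ ys w)
2≤length-merge w (x ∷ xs) ys = ≤-trans (2≤length-merge w xs ys) (n≤1+n _)

2≤cyc-∷ : ∀ {w ys} → All (_< w) ys → 1 ≤ length ys → 2 ≤ cyc (w ∷ ys)
2≤cyc-∷ {ys = y ∷ ys} ys<w _ = ≤-trans (m≤m+n 2 _) (≤-reflexive (sym (cyc-∷-fresh ys<w)))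

-- Removing the tip `p` costs at most two of the four changes, and the fresh `w` restores two.
Special-rest : ∀ {E b w p xs} → Special E b → b ↻ (p ∷ xs) → All (_< w) xs → 4 ≤ cyc (w ∷ xs)
Special-rest {p = p} {xs} sp r xs<w = go xs xs<w 2≤changes
  where
  2≤changes : 2 ≤ changes xs
  2≤changes = ≤-pred (≤-pred (≤-trans (Special.cyc≥4 sp)
    (≤-trans (≤-reflexive (cyc-↻ r)) (enclosed≤ p xs p))))
  go : ∀ {w} xs → All (_< w) xs → 2 ≤ changes xs → 4 ≤ cyc (w ∷ xs)
  go (x ∷ xs) <w 2≤ = ≤-trans (+-monoʳ-≤ 2 2≤) (≤-reflexive (sym (cyc-∷-fresh <w)))

-- Effect of a move on regions, weight and stage

module MoveEffect {w u v : ℕ} {E : Edges} (boundedE : Bounded w E) (u<w : u < w) (v<w : v < w)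
                  (uv : Legal E u v) where

  open Sprout {E = E} boundedE u<w v<w
  open SproutWorth {E = E} boundedE u<w v<w uv
  open Good

  private E′ = sprout w u v E

  AllPairs-lift : ∀ {X} → All (All (_< w)) X → AllPairs (Separated E) X → AllPairs (Separated E′) X
  AllPairs-lift [] [] = []
  AllPairs-lift (b<w ∷ X<w) (sb ∷ sX) =
    All.zipWith (λ (c<w , apart s) → apart (λ x∈ y∈ → Legal-lift (All.lookup b<w x∈) (All.lookup c<w y∈) (s x∈ y∈))) (X<w , sb)
    ∷ AllPairs-lift X<w sX

  All<-lift : ∀ {b} → All (_< w) b → All (_< suc w) b
  All<-lift = All.map m≤n⇒m≤1+n

  Good-lift : ∀ {X} → Good w E X → Good (suc w) E′ X
  Good-lift g = record
    { nonempty = nonempty g ; open-tips = open-tips g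
    ; bounded = All.map All<-lift (bounded g)
    ; separated = AllPairs-lift (bounded g) (separated g) }

  -- The new vertex is adjacent to `u` and `v` only, so it is legal with every old vertex other than
  -- these; all other pairs are inherited.
  Separated-new : ∀ {d e} → All (_< w) e → (∀ {y} → y ∈ e → Legal E u y × Legal E v y) →
                  (∀ {x} → x ∈ d → x ≡ w ⊎ (x < w × (∀ {y} → y ∈ e → Legal E x y))) →
                  Separated E′ d e
  Separated-new {d} {e} e<w sep char = apart new
    where
    new : ∀ {x y} → x ∈ d → y ∈ e → Legal E′ x y
    new x∈ y∈ with char x∈ | sep y∈
    ... | inj₁ refl | (u≢y , _) , (v≢y , _) =
          Legal-sym (Legal-w (All.lookup e<w y∈) (≢-sym u≢y) (≢-sym v≢y))
    ... | inj₂ (x<w , xs) | _ = Legal-lift x<w (All.lookup e<w y∈) (xs y∈)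

  module Merged {b c xs ys R} (b↻ : b ↻ (u ∷ xs)) (c↻ : c ↻ (v ∷ ys)) (g : Good w E (b ∷ c ∷ R)) where

    b<w : All (_< w) (u ∷ xs)
    b<w = All-resp-↭ (↻⇒↭ b↻) (All.head (bounded g))

    c<w : All (_< w) (v ∷ ys)
    c<w = All-resp-↭ (↻⇒↭ c↻) (All.head (All.tail (bounded g)))

    R<w : All (All (_< w)) R
    R<w = All.tail (All.tail (bounded g))

    xs<w = All.tail b<w
    ys<w = All.tail c<w

    b∌v : ∀ {z} → z ∈ b → z ≢ v
    b∌v z∈ = proj₁ (legal (All.head (AllPairs.head (separated g))) z∈ (∈-↻⁻ c↻ (here refl)))

    c∌u : ∀ {z} → z ∈ c → z ≢ u
    c∌u z∈ = ≢-sym (proj₁ (legal (All.head (AllPairs.head (separated g))) (∈-↻⁻ b↻ (here refl)) z∈))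

    merged : Boundary
    merged = xs ++ [ w ] ++ ys ++ [ w ]

    merged-good : Good (suc w) E′ (merged ∷ R)
    merged-good = record
      { nonempty = s≤s z≤n
      ; open-tips = ≤-trans (s≤s z≤n) (2≤length-merge w xs ys) ∷ All.tail (All.tail (open-tips g))
      ; bounded = Allₚ.++⁺ (All<-lift xs<w) (≤-refl ∷ Allₚ.++⁺ (All<-lift ys<w) (≤-refl ∷ []))
                  ∷ All.map All<-lift R<w
      ; separated = All.zipWith (λ {e} (e<w , apart sb , apart sc) →
            Separated-new e<w (λ y∈ → sb (∈-↻⁻ b↻ (here refl)) y∈ , sc (∈-↻⁻ c↻ (here refl)) y∈)
              (λ x∈ → [ inj₁ , [ (λ x∈xs → inj₂ (All.lookup xs<w x∈xs , λ {_} y∈ → sb (∈-↻⁻ b↻ (there x∈xs)) y∈))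
                               , (λ x∈ys → inj₂ (All.lookup ys<w x∈ys , λ {_} y∈ → sc (∈-↻⁻ c↻ (there x∈ys)) y∈)) ]′ ]′
                      (∈-merge⁻ xs ys x∈)))
            (R<w , All.zip (All.tail (AllPairs.head (separated g)) , AllPairs.head (AllPairs.tail (separated g))))
          ∷ AllPairs-lift R<w (AllPairs.tail (AllPairs.tail (separated g)))
      }

    merged-worthˡ : ∀ {m} → Worth E b m → Worth E′ merged m
    merged-worthˡ = Left.merge-worth ys b↻ xs<w b∌v

    merged-worthʳ : ∀ {m} → Worth E c m → Worth E′ merged m
    merged-worthʳ W = Worth-↻ (↻-merge w ys xs) (Right.merge-worth xs c↻ ys<w c∌u W)

  module Cut {b xs ys R₁ R₂} (b↻ : b ↻ (u ∷ xs ++ v ∷ ys)) (g : Good w E (b ∷ R₁ ++ R₂)) where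

    b<w : All (_< w) (u ∷ xs ++ v ∷ ys)
    b<w = All-resp-↭ (↻⇒↭ b↻) (All.head (bounded g))

    xs<w : All (_< w) xs
    xs<w = Allₚ.++⁻ˡ xs (All.tail b<w)

    ys<w : All (_< w) ys
    ys<w = All.tail (Allₚ.++⁻ʳ xs (All.tail b<w))

    R<w : All (All (_< w)) (R₁ ++ R₂)
    R<w = All.tail (bounded g)

    piece-good : ∀ {d S} → All (λ b → 1 ≤ length b) S → All (All (_< w)) S →
                 AllPairs (Separated E) S → All (Separated E b) S →
                 1 ≤ length d → All (_< suc w) d → (∀ {x} → x ∈ d → x ≡ w ⊎ x ∈ xs ++ ys) →
                 Good (suc w) E′ (d ∷ S)
    piece-good S≥1 S<w sS sb d≥1 d<w char = record
      { nonempty = s≤s z≤n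
      ; open-tips = d≥1 ∷ S≥1
      ; bounded = d<w ∷ All.map All<-lift S<w
      ; separated = All.zipWith (λ {e} (e<w , apart s) →
            Separated-new e<w (λ y∈ → s (∈-↻⁻ b↻ (here refl)) y∈ , s (∈-↻⁻ b↻ (there (∈-++⁺ʳ xs (here refl)))) y∈)
              (λ x∈ → [ inj₁ , (λ x∈′ → inj₂ (known x∈′ , λ {_} y∈ → s (∈-↻⁻ b↻ (old x∈′)) y∈)) ]′ (char x∈)))
            (S<w , sb)
          ∷ AllPairs-lift S<w sS
      }
      where
      old : ∀ {x} → x ∈ xs ++ ys → x ∈ u ∷ xs ++ v ∷ ys
      old x∈ = [ (λ x∈xs → there (∈-++⁺ˡ x∈xs)) , (λ x∈ys → there (∈-++⁺ʳ xs (there x∈ys))) ]′ (∈-++⁻ xs x∈)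
      known : ∀ {x} → x ∈ xs ++ ys → x < w
      known x∈ = All.lookup b<w (old x∈)

    pairs : ∀ {S : List Boundary} T → AllPairs (Separated E) (S ++ T) →
            AllPairs (Separated E) S × AllPairs (Separated E) T
    pairs {[]} T p = [] , p
    pairs {_ ∷ S} T (s ∷ p) = let (p₁ , p₂) = pairs T p in Allₚ.++⁻ˡ S s ∷ p₁ , p₂

    private R-pairs = pairs {R₁} R₂ (AllPairs.tail (separated g))

    left-good : Good (suc w) E′ ((xs ++ [ w ]) ∷ R₁)
    left-good = piece-good (Allₚ.++⁻ˡ R₁ (All.tail (open-tips g))) (Allₚ.++⁻ˡ R₁ R<w)
      (proj₁ R-pairs) (Allₚ.++⁻ˡ R₁ (AllPairs.head (separated g)))
      (1≤length-∷ʳ xs w) (Allₚ.++⁺ (All<-lift xs<w) (≤-refl ∷ []))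
      (λ x∈ → [ inj₁ , (λ x∈xs → inj₂ (∈-++⁺ˡ x∈xs)) ]′ (∈-∷ʳ⁻ xs x∈))

    right-good : Good (suc w) E′ (([ w ] ++ ys) ∷ R₂)
    right-good = piece-good (Allₚ.++⁻ʳ R₁ (All.tail (open-tips g))) (Allₚ.++⁻ʳ R₁ R<w)
      (proj₂ R-pairs) (Allₚ.++⁻ʳ R₁ (AllPairs.head (separated g)))
      (s≤s z≤n) (≤-refl ∷ All<-lift ys<w)
      (λ { (here x≡w) → inj₁ x≡w ; (there x∈ys) → inj₂ (∈-++⁺ʳ xs x∈ys) })

    left-worth : ∀ {m} → m ≤ changes (u ∷ xs ++ [ v ]) → Worth E′ (xs ++ [ w ]) m
    left-worth m≤ = Worth-↻ (↻-∷ w xs) (Left.cut-worth xs<w m≤)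

    right-worth : ∀ {m} → m ≤ changes (v ∷ ys ++ [ u ]) → Worth E′ ([ w ] ++ ys) m
    right-worth m≤ = Right.cut-worth ys<w m≤

    cyc-b : cyc b ≡ changes (u ∷ xs ++ [ v ]) + changes (v ∷ ys ++ [ u ])
    cyc-b = trans (cyc-↻ b↻) (cyc-split u xs v ys)

  good-step : ∀ {Rs Rs′} → All (Good w E) Rs → Curve [ w ] u v Rs Rs′ → All (Good (suc w) E′) Rs′
  good-step G (across π ρ b↻ c↻) with All-resp-↭ π G
  ... | g ∷ G′ = Merged.merged-good b↻ c↻ (Good-↭ ρ g) ∷ All.map Good-lift G′
  good-step G (within π ρ b↻) with All-resp-↭ π G
  ... | g ∷ G′ = Cut.left-good b↻ (Good-↭ ρ g) ∷ Cut.right-good b↻ (Good-↭ ρ g) ∷ All.map Good-lift G′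

  Worth-lift : ∀ {b m} → All (_< w) b → Worth E b m → Worth E′ b m
  Worth-lift b<w (inj₁ m≤1) = inj₁ m≤1
  Worth-lift b<w (inj₂ (h , m≤)) = inj₂ (HasLegal-lift b<w h , m≤)

  Any-lift : ∀ {P Q : Boundary → Set} {X} → (∀ {b} → All (_< w) b → P b → Q b) →
             All (All (_< w)) X → Any P X → Any Q X
  Any-lift f (b<w ∷ _) (here p) = here (f b<w p)
  Any-lift f (_ ∷ X<w) (there p) = there (Any-lift f X<w p)

  WorthR-lift : ∀ {X m} → All (All (_< w)) X → WorthR E X m → WorthR E′ X m
  WorthR-lift X<w (inj₁ m≤1) = inj₁ m≤1
  WorthR-lift X<w (inj₂ p) = inj₂ (Any-lift Worth-lift X<w p)

  Weight-lift : ∀ {Rs m} → All (Good w E) Rs → Weight E Rs m → Weight E′ Rs m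
  Weight-lift [] [] = []
  Weight-lift (g ∷ G) (add V W m≤) = add (WorthR-lift (bounded g) V) (Weight-lift G W) m≤

  Special-lift : ∀ {b} → All (_< w) b → Special E b → Special E′ b
  Special-lift b<w sp = record
    { has-legal = HasLegal-lift b<w has-legal
    ; cyc≥4 = cyc≥4
    ; split = λ r xy → split r (Legal-lower xy) }
    where open Special sp

  -- If the component that carries the weight is merged, the merged word inherits its weight; if it
  -- is cut, the two arcs share its changes. Weight carried by an untouched component moves with it,
  -- and the other half of a cut region is credited 0.
  weight-step : ∀ {Rs Rs′ m} → All (Good w E) Rs → Curve [ w ] u v Rs Rs′ → Weight E Rs m → Weight E′ Rs′ m
  weight-step G (across {R = R} π ρ b↻ c↻) W with All-resp-↭ π G | Weight-↭ π W
  ... | g ∷ G′ | add {m = m} V W′ m≤ = add (merged-worth V) (Weight-lift G′ W′) m≤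
    where
    open Merged b↻ c↻ (Good-↭ ρ g)
    merged-worth : WorthR E _ m → WorthR E′ (merged ∷ R) m
    merged-worth (inj₁ m≤1) = inj₁ m≤1
    merged-worth (inj₂ p) with Any-resp-↭ ρ p
    ... | here p′ = inj₂ (here (merged-worthˡ p′))
    ... | there (here p′) = inj₂ (here (merged-worthʳ p′))
    ... | there (there p′) = inj₂ (there (Any-lift Worth-lift R<w p′))
  weight-step {m = n} G (within {xs = xs} {ys} {R₁} {R₂} π ρ b↻) W with All-resp-↭ π G | Weight-↭ π W
  ... | g ∷ G′ | add {m = m} {k} V W′ n≤ =
    let (k₁ , k₂ , m≤ , V₁ , V₂) = cut-worth V in
    add V₁ (add V₂ (Weight-lift G′ W′) ≤-refl)
      (≤-trans n≤ (≤-trans (+-monoˡ-≤ k m≤) (≤-reflexive (+-assoc k₁ k₂ k))))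
    where
    open Cut {R₁ = R₁} {R₂} b↻ (Good-↭ ρ g)
    cut-worth : WorthR E _ m → ∃[ k₁ ] ∃[ k₂ ]
      (m ≤ k₁ + k₂ × WorthR E′ ((xs ++ [ w ]) ∷ R₁) k₁ × WorthR E′ (([ w ] ++ ys) ∷ R₂) k₂)
    cut-worth (inj₁ m≤1) = m , 0 , m≤m+n m 0 , inj₁ m≤1 , inj₁ z≤n
    cut-worth (inj₂ p) with Any-resp-↭ ρ p
    ... | here (inj₁ m≤1) = m , 0 , m≤m+n m 0 , inj₁ m≤1 , inj₁ z≤n
    ... | here (inj₂ (_ , m≤)) = _ , _ , ≤-trans m≤ (≤-reflexive cyc-b) ,
            inj₂ (here (left-worth ≤-refl)) , inj₂ (here (right-worth ≤-refl))
    ... | there p′ with Anyₚ.++⁻ R₁ p′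
    ...   | inj₁ p₁ = m , 0 , m≤m+n m 0 ,
              inj₂ (there (Any-lift Worth-lift (Allₚ.++⁻ˡ R₁ R<w) p₁)) , inj₁ z≤n
    ...   | inj₂ p₂ = 0 , m , ≤-refl , inj₁ z≤n ,
              inj₂ (there (Any-lift Worth-lift (Allₚ.++⁻ʳ R₁ R<w) p₂))

  Sound-lift : ∀ {Ss Ss′ b} → (Weight E Ss 2 → Weight E′ Ss′ 2) → (Ss′ ≡ [] → Ss ≡ []) →
               Sound E Ss b → Sound E′ Ss′ b
  Sound-lift f empty (inj₁ (2≤b , alone)) = inj₁ (2≤b , λ eq → alone (empty eq))
  Sound-lift f empty (inj₂ W) = inj₂ (f W)

  middle-across : ∀ {x X Rs Ss b c xs ys R} → Rs ↭ ((xs ++ [ w ] ++ ys ++ [ w ]) ∷ R) ∷ Ss →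
                  X ↭ b ∷ c ∷ R → b ↻ (u ∷ xs) → c ↻ (v ∷ ys) → Good w E X → All (Good w E) Ss →
                  Any (Special E) X → All (Sound E Ss) X → Stage x E′ Rs
  middle-across {x} {X} {Rs} {Ss} {b} {c} {xs} {ys} {R} π ρ b↻ c↻ g G sp snd =
    go (Any-resp-↭ ρ sp) (All-resp-↭ ρ snd)
    where
    open Merged b↻ c↻ (Good-↭ ρ g)

    rest≥1 : ∀ {e z zs} → e ↻ (z ∷ zs) → 2 ≤ length e → 1 ≤ length zs
    rest≥1 r 2≤ = ≤-pred (subst (2 ≤_) (↭-length (↻⇒↭ r)) 2≤)

    -- An empty list cannot weigh 2, so both components have a second tip, and each arc of the
    -- merged word has two changes.
    alone : Sound E [] b → Sound E [] c → 3 ≤ cyc merged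
    alone (inj₁ (2≤b , _)) (inj₁ (2≤c , _)) = ≤-trans (n≤1+n 3) (≤-trans
      (+-mono-≤ (2≤cyc-∷ xs<w (rest≥1 b↻ 2≤b)) (2≤cyc-∷ ys<w (rest≥1 c↻ 2≤c)))
      (≤-reflexive (sym (cyc-merge w xs ys))))
    alone (inj₂ ()) _
    alone (inj₁ _) (inj₂ ())

    -- The arc of the special word gives 4. The missing 2 come from the arc of the other component
    -- if it keeps a tip, and from the remaining regions otherwise.
    absorb : ∀ {a e z zs} → 4 ≤ a → cyc merged ≡ a + cyc (w ∷ zs) → HasLegal E′ merged →
             e ↻ (z ∷ zs) → All (_< w) zs → Sound E Ss e → Stage x E′ Rs
    absorb 4≤a eq h r zs<w (inj₁ (2≤e , _)) = late (Weight-↭ (↭-sym π)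
      (add {m = 6} (inj₂ (here (inj₂ (h ,
             ≤-trans (+-mono-≤ 4≤a (2≤cyc-∷ zs<w (rest≥1 r 2≤e))) (≤-reflexive (sym eq))))))
           (Weight-length Ss z≤n) ≤-refl))
    absorb 4≤a eq h r zs<w (inj₂ W) = late (Weight-↭ (↭-sym π)
      (add {m = 4} (inj₂ (here (inj₂ (h , ≤-trans (≤-trans 4≤a (m≤m+n _ _)) (≤-reflexive (sym eq))))))
           (Weight-lift G W) ≤-refl))

    go : Any (Special E) (b ∷ c ∷ R) → All (Sound E Ss) (b ∷ c ∷ R) → Stage x E′ Rs
    go (here sp) (_ ∷ sc ∷ _) = absorb (Special-rest sp b↻ xs<w) (cyc-merge w xs ys)
      (Left.merge-HasLegal ys b↻ xs<w b∌v (Special.has-legal sp)) c↻ ys<w sc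
    go (there (here sp)) (sb ∷ _ ∷ _) = absorb (Special-rest sp c↻ ys<w)
      (trans (cyc-merge w xs ys) (+-comm (cyc (w ∷ xs)) (cyc (w ∷ ys))))
      (HasLegal-⊆ (∈-↻ (↻-merge w ys xs)) (Right.merge-HasLegal xs c↻ ys<w c∌u (Special.has-legal sp)))
      b↻ xs<w sb
    go (there (there sp)) (sb ∷ sc ∷ sR) = middle π (there (Any-lift Special-lift R<w sp))
      (inj₁ (2≤length-merge w xs ys , λ { refl → inj₂ (alone sb sc) })
       ∷ All.map (Sound-lift (Weight-lift G) (λ eq → eq)) sR)

  middle-within : ∀ {x X Rs Ss b xs ys R₁ R₂} →
                  Rs ↭ ((xs ++ [ w ]) ∷ R₁) ∷ (([ w ] ++ ys) ∷ R₂) ∷ Ss →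
                  X ↭ b ∷ R₁ ++ R₂ → b ↻ (u ∷ xs ++ v ∷ ys) → Good w E X → All (Good w E) Ss →
                  Any (Special E) X → All (Sound E Ss) X → Stage x E′ Rs
  middle-within {x} {X} {Rs} {Ss} {b} {xs} {ys} {R₁} {R₂} π ρ b↻ g G sp snd =
    go (Any-resp-↭ ρ sp) (All-resp-↭ ρ snd)
    where
    open Cut {R₁ = R₁} {R₂} b↻ (Good-↭ ρ g)
    L = (xs ++ [ w ]) ∷ R₁
    M = ([ w ] ++ ys) ∷ R₂

    worthy : ∀ {z zs} → z ∈ zs → All (_< w) zs → 2 + changes zs ≤ cyc (w ∷ zs)
    worthy {zs = _ ∷ _} _ zs<w = ≤-reflexive (sym (cyc-∷-fresh zs<w))

    -- A constant component cannot be cut, because the ends of the curve are distinct.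
    cyc≥3 : Sound E [] b → 3 ≤ cyc b
    cyc≥3 (inj₁ (_ , alone)) with alone refl
    ... | inj₁ (i , b≡i) = ⊥-elim (proj₁ uv (trans
            (All.lookup b≡i (∈-↻⁻ b↻ (here refl)))
            (sym (All.lookup b≡i (∈-↻⁻ b↻ (there (∈-++⁺ʳ xs (here refl))))))))
    ... | inj₂ 3≤ = 3≤
    cyc≥3 (inj₂ ())

    remaining≥2 : ∀ {m n} → 3 ≤ m + n → m ≤ 1 → 2 ≤ n
    remaining≥2 3≤ m≤1 = ≤-pred (≤-trans 3≤ (+-monoˡ-≤ _ m≤1))

    -- When the left piece is a single tip, its arc has at most one of the three changes, so the
    -- right piece has weight 2.
    busyʳ : Sound E [] b → xs ≡ [] → Worth E′ ([ w ] ++ ys) 2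
    busyʳ s refl = right-worth (remaining≥2 (subst (3 ≤_) cyc-b (cyc≥3 s)) (changes-constantˡ v []))

    busyˡ : Sound E [] b → ys ≡ [] → Worth E′ (xs ++ [ w ]) 2
    busyˡ s refl = left-worth (remaining≥2 (subst (3 ≤_) (trans cyc-b (+-comm (changes (u ∷ xs ++ [ v ])) _)) (cyc≥3 s))
      (changes-constantˡ u []))

    others : ∀ {c Y} → Sound E Ss c → Sound E′ (Y ∷ Ss) c
    others = Sound-lift (λ W → add (inj₁ z≤n) (Weight-lift G W) ≤-refl) (λ ())

    -- Two regions weigh 2 in any case, so `Y` must weigh 2 by itself only when it is the sole other
    -- region.
    sibling : ∀ Y S → (S ≡ [] → WorthR E′ Y 2) → Weight E′ (Y ∷ S) 2
    sibling Y [] f = add (f refl) [] ≤-refl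
    sibling Y (Z ∷ S) f = Weight-length (Y ∷ Z ∷ S) (s≤s (s≤s z≤n))

    empty? : ∀ (zs : Boundary) → zs ≡ [] ⊎ 1 ≤ length zs
    empty? [] = inj₁ refl
    empty? (_ ∷ _) = inj₂ (s≤s z≤n)

    soundˡ : Sound E Ss b → Sound E′ (M ∷ Ss) (xs ++ [ w ])
    soundˡ s with empty? xs
    ... | inj₁ xs≡[] = inj₂ (sibling M Ss λ { refl → inj₂ (here (busyʳ s xs≡[])) })
    ... | inj₂ 1≤xs = inj₁ (subst (2 ≤_) (sym (length-++ xs)) (+-monoˡ-≤ 1 1≤xs) , λ ())

    soundʳ : Sound E Ss b → Sound E′ (L ∷ Ss) ([ w ] ++ ys)
    soundʳ s with empty? ys
    ... | inj₁ ys≡[] = inj₂ (sibling L Ss λ { refl → inj₂ (here (busyˡ s ys≡[])) })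
    ... | inj₂ 1≤ys = inj₁ (s≤s 1≤ys , λ ())

    go : Any (Special E) (b ∷ R₁ ++ R₂) → All (Sound E Ss) (b ∷ R₁ ++ R₂) → Stage x E′ Rs
    -- The special word is cut: each piece has 2 changes around the new vertex besides those of its
    -- segment, and the segments contribute at least 2 more.
    go (here sp) _ = late (Weight-↭ (↭-sym π)
      (add (inj₂ (here (Worth-↻ (↻-∷ w xs) (inj₂
              (Left.HasLegal-w (here refl) (there separator∈ˡ) (All.lookup xs<w separator∈ˡ) separator≢ˡ separator≢ʳ
              , worthy separator∈ˡ xs<w)))))
        (add (inj₂ (here (inj₂
              (Left.HasLegal-w (here refl) (there separator∈ʳ) (All.lookup ys<w separator∈ʳ) separator≢ˡ separator≢ʳ
              , worthy separator∈ʳ ys<w))))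
          (Weight-length Ss z≤n) ≤-refl)
        enough))
      where
      open Split (Special.split sp b↻ uv)
      open ≤-Reasoning
      enough : 6 ≤ (2 + changes xs) + ((2 + changes ys) + 0)
      enough = begin
        6                                         ≤⟨ +-monoʳ-≤ 4 changes≥2 ⟩
        4 + (changes xs + changes ys)             ≡⟨ cong (2 +_) (sym (m+2+n (changes xs) (changes ys))) ⟩
        (2 + changes xs) + (2 + changes ys)       ≡⟨ cong ((2 + changes xs) +_) (+-identityʳ (2 + changes ys)) ⟨
        (2 + changes xs) + ((2 + changes ys) + 0) ∎
        where
        m+2+n : ∀ m n → m + (2 + n) ≡ 2 + (m + n)
        m+2+n m n = trans (+-suc m (suc n)) (cong suc (+-suc m n))
    go (there sp) (sb ∷ sR) with Anyₚ.++⁻ R₁ sp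
    ... | inj₁ sp₁ = middle π (there (Any-lift Special-lift (Allₚ.++⁻ˡ R₁ R<w) sp₁))
            (soundˡ sb ∷ All.map others (Allₚ.++⁻ˡ R₁ sR))
    ... | inj₂ sp₂ = middle (↭-trans π (swap L M refl)) (there (Any-lift Special-lift (Allₚ.++⁻ʳ R₁ R<w) sp₂))
            (soundʳ sb ∷ All.map others (Allₚ.++⁻ʳ R₁ sR))

  -- Every component comes from one spot, so no cut is legal; the first move merges two spots, each
  -- of which keeps at least two of its tips.
  opening-step : ∀ {x X Rs′} → All (Good w E) [ X ] → Curve [ w ] u v [ X ] Rs′ →
                 All (λ b → Constant b × 3 ≤ length b) X → Stage x E′ Rs′
  opening-step G (within {xs = xs} π ρ b↻) consts with ↭-∷-inv π
  ... | inj₂ (zs , σ , _) = ⊥-elim (¬x∷xs↭[] (↭-sym σ))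
  ... | inj₁ (refl , _) with All-resp-↭ ρ consts
  ...   | ((i , b≡i) , _) ∷ _ = ⊥-elim (proj₁ uv (trans
            (All.lookup b≡i (∈-↻⁻ b↻ (here refl)))
            (sym (All.lookup b≡i (∈-↻⁻ b↻ (there (∈-++⁺ʳ xs (here refl))))))))
  opening-step (g ∷ []) (across {b = b} {c} {xs} {ys} {R} π ρ b↻ c↻) consts with ↭-∷-inv π
  ... | inj₂ (zs , σ , _) = ⊥-elim (¬x∷xs↭[] (↭-sym σ))
  ... | inj₁ (refl , σ) with ↭-empty-inv (↭-sym σ) | All-resp-↭ ρ consts
  ...   | refl | ((i , b≡i) , 3≤b) ∷ ((j , c≡j) , 3≤c) ∷ cR =
            middle refl (here special-merged)
              (inj₁ (2≤length-merge w xs ys , λ _ → inj₂ (≤-trans (n≤1+n 3) (Special.cyc≥4 special-merged)))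
               ∷ All.map (λ (const , 3≤) → inj₁ (≤-trans (n≤1+n 2) 3≤ , λ _ → inj₁ const)) cR)
    where
    rest≥2 : ∀ {e z zs} → e ↻ (z ∷ zs) → 3 ≤ length e → 2 ≤ length zs
    rest≥2 r 3≤ = ≤-pred (subst (3 ≤_) (↭-length (↻⇒↭ r)) 3≤)
    rest-const : ∀ {e z zs k} → e ↻ (z ∷ zs) → All (_≡ k) e → All (_≡ z) zs
    rest-const r e≡k with All-resp-↭ (↻⇒↭ r) e≡k
    ... | refl ∷ zs≡k = zs≡k
    special-merged : Special E′ (xs ++ [ w ] ++ ys ++ [ w ])
    special-merged = Alternating.special u<w v<w (zero , ends (inj₁ refl))
      (suc zero , ends (inj₂ refl)) uv′
      (rest-const b↻ b≡i) (rest-const c↻ c≡j) (rest≥2 b↻ 3≤b) (rest≥2 c↻ 3≤c)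

  stage-step : ∀ {x Rs Rs′} → All (Good w E) Rs → Curve [ w ] u v Rs Rs′ → Stage x E Rs → Stage (suc x) E′ Rs′
  stage-step G κ (opening _ refl consts) = opening-step G κ consts
  stage-step G κ (late W) = late (weight-step G κ W)
  stage-step G (across {X = Y} p ρ b↻ c↻) (middle {X} {Ss} π sp snd)
    with ↭-∷-inv (↭-trans (↭-sym π) p) | All-resp-↭ π G
  ... | inj₁ (refl , σ) | g ∷ G′ = middle-across (prep _ (↭-sym σ)) ρ b↻ c↻ g G′ sp snd
  -- The move happens away from the special word. The regions it produces are among the others, so
  -- their list cannot become empty.
  ... | inj₂ (Q , σ , τ) | g ∷ G′ = middle (↭-trans (prep _ τ) (swap _ _ refl))
          (Any-lift Special-lift (bounded g) sp)
          (All.map (Sound-lift (weight-step G′ (across σ ρ b↻ c↻)) (λ ())) snd)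
  stage-step G (within {X = Y} {R₁ = R₁} {R₂} p ρ b↻) (middle {X} {Ss} π sp snd)
    with ↭-∷-inv (↭-trans (↭-sym π) p) | All-resp-↭ π G
  ... | inj₁ (refl , σ) | g ∷ G′ = middle-within (prep _ (prep _ (↭-sym σ))) ρ b↻ g G′ sp snd
  ... | inj₂ (Q , σ , τ) | g ∷ G′ =
          middle (↭-trans (prep _ (prep _ τ)) (↭-trans (prep _ (swap _ _ refl)) (swap _ _ refl)))
          (Any-lift Special-lift (bounded g) sp)
          (All.map (Sound-lift (weight-step G′ (within {R₁ = R₁} {R₂} σ ρ b↻)) (λ ())) snd)

-- Drawings

-- Needed because `add-vertex` appends the newest spot on the right, while `tabulate` unfolds from
-- the left.
tabulate-∷ʳ : ∀ {A : Set} {n} (f : Fin (suc n) → A) → tabulate f ≡ tabulate (λ i → f (inject₁ i)) ∷ʳ f (fromℕ n)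
tabulate-∷ʳ {n = zero} f = refl
tabulate-∷ʳ {n = suc n} f = cong (f zero ∷_) (tabulate-∷ʳ (λ i → f (suc i)))

spots : ∀ {n} → (Fin n → ℕ) → Region
spots t = tabulate (λ i → replicate (t i) (toℕ i))

initial-drawn : ∀ n (t : Fin n → ℕ) → Drawn (mkGraph n []) [ spots t ]
initial-drawn zero t = blank
initial-drawn (suc n) t = subst (λ X → Drawn (mkGraph (suc n) []) [ X ]) eq
  (add-vertex (t (fromℕ n)) (initial-drawn n (λ i → t (inject₁ i))) refl)
  where
  eq : spots (λ i → t (inject₁ i)) ∷ʳ replicate (t (fromℕ n)) n ≡ spots t
  eq = trans (cong₂ _∷ʳ_ (tabulate-cong (λ i → cong (replicate _) (sym (toℕ-inject₁ i))))
                            (cong (replicate _) (sym (toℕ-fromℕ n))))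
               (sym (tabulate-∷ʳ (λ i → replicate (t i) (toℕ i))))

↻-trans : ∀ {b c d} → b ↻ c → c ↻ d → b ↻ d
↻-trans (rotate as bs) r = go r refl
  where
  go : ∀ {c d} → c ↻ d → c ≡ bs ++ as → (as ++ bs) ↻ d
  go (rotate p q) eq with levi p bs eq
  ... | inj₁ (e , refl , refl) = subst₂ _↻_ (++-assoc as p e) (sym (++-assoc e as p)) (rotate (as ++ p) e)
  ... | inj₂ (f , refl , refl) = subst₂ _↻_ (sym (++-assoc f q bs)) (++-assoc q bs f) (rotate f (q ++ bs))

-- The new vertex is placed with four tips; restoring the edge to v and then the edge
-- to u, with suitable choices among the tips of w, leaves exactly the same regions.
sprout-drawn : ∀ {w E Rs Rs′ u v} → Drawn (mkGraph w E) Rs → Curve [ w ] u v Rs Rs′ →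
               Drawn (mkGraph (suc w) (sprout w u v E)) Rs′
sprout-drawn {w} {E} {u = u} {v} D (across {X} {Ss} {b} {c} {xs} {ys} {R} π ρ b↻ c↻) =
  subst (λ d → Drawn (mkGraph (suc w) (sprout w u v E)) ((d ∷ R) ∷ Ss)) (cong (xs ++_) (++-identityʳ (w ∷ ys ++ [ w ])))
    (add-edge (add-edge (add-vertex 4 D π) first) second)
  where
  first : Curve [] w v ((X ∷ʳ replicate 4 w) ∷ Ss) (((w ∷ w ∷ w ∷ ys ++ []) ∷ b ∷ R) ∷ Ss)
  first = across refl
    (↭-trans (↭-sym (∷↭∷ʳ _ X)) (prep _ (↭-trans ρ (swap b c refl))))
    (rotate (replicate 4 w) []) c↻
  second : Curve [] u w (((w ∷ w ∷ w ∷ ys ++ []) ∷ b ∷ R) ∷ Ss) (((xs ++ (w ∷ ys ++ [ w ]) ++ []) ∷ R) ∷ Ss)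
  second = across refl (swap _ b refl) b↻
    -- The middle one of the three remaining tips of `w` is used, which leaves one tip on each side
    -- of `ys`.
    (subst (λ zs → (w ∷ w ∷ w ∷ zs) ↻ (w ∷ w ∷ ys ++ [ w ])) (sym (++-identityʳ ys)) (rotate [ w ] (w ∷ w ∷ ys)))
sprout-drawn {w} {E} {u = u} {v} D (within {X} {Ss} {b} {xs} {ys} {R₁} {R₂} π ρ b↻) =
  subst (λ d → Drawn (mkGraph (suc w) (sprout w u v E)) ((d ∷ R₁) ∷ (([ w ] ++ ys) ∷ R₂) ∷ Ss)) (++-identityʳ (xs ++ [ w ]))
    (add-edge (add-edge (add-vertex 4 D π) first) second)
  where
  first : Curve [] w v ((X ∷ʳ replicate 4 w) ∷ Ss) (((w ∷ w ∷ w ∷ (ys ++ u ∷ xs) ++ []) ∷ R₁ ++ R₂) ∷ Ss)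
  first = across refl (↭-trans (↭-sym (∷↭∷ʳ _ X)) (prep _ ρ)) (rotate (replicate 4 w) [])
    (↻-trans b↻ (rotate (u ∷ xs) (v ∷ ys)))
  second : Curve [] u w (((w ∷ w ∷ w ∷ (ys ++ u ∷ xs) ++ []) ∷ R₁ ++ R₂) ∷ Ss)
                        ((((xs ++ [ w ]) ++ []) ∷ R₁) ∷ (([ w ] ++ ys) ∷ R₂) ∷ Ss)
  second = within {R₁ = R₁} {R₂} refl refl
    (subst₂ _↻_ (cong (λ l → w ∷ w ∷ w ∷ l) (sym (++-identityʳ (ys ++ u ∷ xs))))
      (cong (u ∷_) (sym (++-assoc xs [ w ] (w ∷ w ∷ ys))))
      (rotate (w ∷ w ∷ w ∷ ys) (u ∷ xs)))

-- Counting

boundaries : List Region → ℕ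
boundaries Rs = ∑ (map length Rs)

tipsʳ : Region → ℕ
tipsʳ X = ∑ (map length X)

tips : List Region → ℕ
tips Rs = ∑ (map tipsʳ Rs)

boundaries-step : ∀ {s u v Rs Rs′} → Curve s u v Rs Rs′ →
  (boundaries Rs ≡ suc (boundaries Rs′) × length Rs′ ≡ length Rs) ⊎
  (boundaries Rs′ ≡ suc (boundaries Rs) × length Rs′ ≡ suc (length Rs))
boundaries-step {Rs = Rs} (across {X} {Ss = Ss} {R = R} π ρ _ _) = inj₁
  ( trans (sum-↭ (map⁺ length π)) (cong (_+ boundaries Ss) (↭-length ρ))
  , sym (↭-length π))
boundaries-step {Rs = Rs} (within {X} {Ss = Ss} {R₁ = R₁} {R₂} π ρ _) = inj₂
  ( (begin
      suc (length R₁) + (suc (length R₂) + boundaries Ss)   ≡⟨ cong suc (+-suc (length R₁) _) ⟩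
      2 + (length R₁ + (length R₂ + boundaries Ss))         ≡⟨ cong (2 +_) (+-assoc (length R₁) _ _) ⟨
      2 + (length R₁ + length R₂ + boundaries Ss)           ≡⟨ cong (λ k → 2 + (k + boundaries Ss)) (length-++ R₁) ⟨
      2 + (length (R₁ ++ R₂) + boundaries Ss)               ≡⟨ cong (λ k → suc (k + boundaries Ss)) (↭-length ρ) ⟨
      suc (length X + boundaries Ss)                        ≡⟨ cong suc (sum-↭ (map⁺ length π)) ⟨
      suc (boundaries Rs)                                   ∎)
  , cong suc (sym (↭-length π)))
  where open ≡-Reasoning

tipsʳ-++ : ∀ X Y → tipsʳ (X ++ Y) ≡ tipsʳ X + tipsʳ Y
tipsʳ-++ X Y = trans (cong ∑ (map-++ length X Y)) (sum-++ (map length X) (map length Y))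

tips-step : ∀ {w u v Rs Rs′} → Curve [ w ] u v Rs Rs′ → tips Rs′ ≡ tips Rs
tips-step {w} {u} {v} {Rs} (across {X} {Ss} {b} {c} {xs} {ys} {R} π ρ b↻ c↻) = sym (begin
  tips Rs                                              ≡⟨ sum-↭ (map⁺ tipsʳ π) ⟩
  tipsʳ X + tips Ss                                    ≡⟨ cong (_+ tips Ss) (sum-↭ (map⁺ length ρ)) ⟩
  (length b + (length c + tipsʳ R)) + tips Ss          ≡⟨ cong (_+ tips Ss) (+-assoc (length b) (length c) (tipsʳ R)) ⟨
  (length b + length c + tipsʳ R) + tips Ss
    ≡⟨ cong (λ k → k + tipsʳ R + tips Ss) (cong₂ _+_ (↭-length (↻⇒↭ b↻)) (↭-length (↻⇒↭ c↻))) ⟩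
  (suc (length xs) + suc (length ys) + tipsʳ R) + tips Ss  ≡⟨ cong (λ k → k + tipsʳ R + tips Ss) merged ⟨
  (length (xs ++ [ w ] ++ ys ++ [ w ]) + tipsʳ R) + tips Ss ∎)
  where
  open ≡-Reasoning
  merged : length (xs ++ [ w ] ++ ys ++ [ w ]) ≡ suc (length xs) + suc (length ys)
  merged = trans (length-++ xs) (trans (cong (λ k → length xs + suc k) (trans (length-++ ys) (+-comm _ 1))) (+-suc (length xs) _))
tips-step {w} {u} {v} {Rs} (within {X} {Ss} {b} {xs} {ys} {R₁} {R₂} π ρ b↻) = sym (begin
  tips Rs                                              ≡⟨ sum-↭ (map⁺ tipsʳ π) ⟩
  tipsʳ X + tips Ss                                    ≡⟨ cong (_+ tips Ss) (sum-↭ (map⁺ length ρ)) ⟩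
  (length b + tipsʳ (R₁ ++ R₂)) + tips Ss              ≡⟨ cong (λ k → length b + k + tips Ss) (tipsʳ-++ R₁ R₂) ⟩
  (length b + (tipsʳ R₁ + tipsʳ R₂)) + tips Ss
    ≡⟨ cong (λ k → k + (tipsʳ R₁ + tipsʳ R₂) + tips Ss) (trans (↭-length (↻⇒↭ b↻)) (cong suc (length-++ xs))) ⟩
  (suc (length xs + suc (length ys)) + (tipsʳ R₁ + tipsʳ R₂)) + tips Ss
    ≡⟨ arrange (length xs) (length ys) (tipsʳ R₁) (tipsʳ R₂) (tips Ss) ⟩
  (length xs + 1) + tipsʳ R₁ + (suc (length ys) + tipsʳ R₂ + tips Ss)
    ≡⟨ cong (λ k → k + tipsʳ R₁ + (suc (length ys) + tipsʳ R₂ + tips Ss)) (length-++ xs) ⟨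
  length (xs ++ [ w ]) + tipsʳ R₁ + (suc (length ys) + tipsʳ R₂ + tips Ss) ∎)
  where
  open ≡-Reasoning
  open +-*-Solver
  arrange : ∀ x y a b s → (suc (x + suc y) + (a + b)) + s ≡ (x + 1) + a + (suc y + b + s)
  arrange = solve 5 (λ x y a b s → (con 1 :+ (x :+ (con 1 :+ y)) :+ (a :+ b)) :+ s
                                := (x :+ con 1) :+ a :+ ((con 1 :+ y) :+ b :+ s)) refl

-- The invariant of a play

record Invariant (n total x : ℕ) (P : Position) : Set where
  field
    drawn      : Drawn (graph P) (regions P)
    bounded    : Bounded (order (graph P)) (edges (graph P))
    girth      : Girth≥4 (edges (graph P))
    good       : All (Good (order (graph P)) (edges (graph P))) (regions P)
    stage      : Stage x (edges (graph P)) (regions P)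
    -- Euler's formula V - E + F = 1 + K with V = n + x, E = 2x, F = r, where the number K of
    -- connected components of the graph is c - r + 1; written additively to avoid subtraction.
    euler      : x + boundaries (regions P) + 2 ≡ length (regions P) + length (regions P) + n
    total-tips : tips (regions P) ≡ total

curve-ends< : ∀ {s w E u v Rs Rs′} → All (Good w E) Rs → Curve s u v Rs Rs′ → u < w × v < w
curve-ends< G (across π ρ b↻ c↻) with All-resp-↭ ρ (Good.bounded (All.head (All-resp-↭ π G)))
... | b<w ∷ c<w ∷ _ = All.head (All-resp-↭ (↻⇒↭ b↻) b<w) , All.head (All-resp-↭ (↻⇒↭ c↻) c<w)
curve-ends< G (within {xs = xs} π ρ b↻) with All-resp-↭ ρ (Good.bounded (All.head (All-resp-↭ π G)))
... | b<w ∷ _ with All-resp-↭ (↻⇒↭ b↻) b<w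
...   | u<w ∷ rest<w = u<w , All.head (Allₚ.++⁻ʳ xs rest<w)

initial-invariant : ∀ {n} → 1 ≤ n → (t : Fin n → ℕ) → (∀ i → 3 ≤ t i) →
                    Invariant n (∑ (tabulate t)) 0 (initial t)
initial-invariant {n} 1≤n t t≥3 = record
  { drawn = initial-drawn n t
  ; bounded = λ { (() , _) }
  ; girth = record { no-loop = λ { {()} } ; no-parallel = λ { {()} } ; no-triangle = λ { {()} } }
  ; good = record
      { nonempty = subst (1 ≤_) (sym (length-tabulate spot)) 1≤n
      ; open-tips = Allₚ.tabulate⁺ (λ i → ≤-trans (s≤s z≤n) (spot≥3 i))
      ; bounded = Allₚ.tabulate⁺ (λ i → Allₚ.replicate⁺ (t i) (toℕ<n i))
      ; separated = AllPairsₚ.tabulate⁺ (λ {i} {j} i≢j → apart (λ x∈ y∈ →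
          (λ x≡y → i≢j (toℕ-injective (trans (sym (label x∈)) (trans x≡y (label y∈))))) , λ { (() , _) }))
      } ∷ []
  ; stage = opening refl refl
      (Allₚ.tabulate⁺ (λ i → (toℕ i , Allₚ.replicate⁺ (t i) refl) , spot≥3 i))
  ; euler = trans (cong (λ k → k + 0 + 2) (length-tabulate spot)) (trans (cong (_+ 2) (+-identityʳ n)) (+-comm n 2))
  ; total-tips = trans (+-identityʳ _) (cong ∑ (trans (map-tabulate spot length)
      (tabulate-cong (λ i → length-replicate (t i)))))
  }
  where
  spot : Fin n → Boundary
  spot i = replicate (t i) (toℕ i)
  spot≥3 : ∀ i → 3 ≤ length (spot i)
  spot≥3 i = subst (3 ≤_) (sym (length-replicate (t i))) (t≥3 i)
  label : ∀ {i x} → x ∈ spot i → x ≡ toℕ i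
  label {i} x∈ = All.lookup {P = _≡ toℕ i} (Allₚ.replicate⁺ (t i) refl) x∈

euler-step : ∀ {s u v Rs Rs′ x n} → Curve s u v Rs Rs′ →
             x + boundaries Rs + 2 ≡ length Rs + length Rs + n →
             suc x + boundaries Rs′ + 2 ≡ length Rs′ + length Rs′ + n
euler-step {Rs = Rs} {Rs′} {x} {n} κ eq with boundaries-step κ
... | inj₁ (b≡ , r≡) rewrite r≡ = trans (cong (_+ 2) (sym (trans (cong (x +_) b≡) (+-suc x _)))) eq
... | inj₂ (b≡ , r≡) rewrite r≡ | b≡ = trans
        (solve 2 (λ x b → con 1 :+ x :+ (con 1 :+ b) :+ con 2 := con 2 :+ (x :+ b :+ con 2)) refl x (boundaries Rs))
        (trans (cong (2 +_) eq)
        (solve 2 (λ r n → con 2 :+ (r :+ r :+ n) := con 1 :+ r :+ (con 1 :+ r) :+ n) refl (length Rs) n))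
  where open +-*-Solver

move-invariant : ∀ {n total x P Q} → Invariant n total x P → Move 𝒫₄ P Q → Invariant n total (suc x) Q
move-invariant {P = P} I (move {u} {v} κ (_ , girth≥4)) = record
  { drawn = sprout-drawn drawn κ
  ; bounded = Sprout.sprout-bounded bounded u<w v<w
  ; girth = girth′
  ; good = MoveEffect.good-step bounded u<w v<w uv good κ
  ; stage = MoveEffect.stage-step bounded u<w v<w uv good κ stage
  ; euler = euler-step κ euler
  ; total-tips = trans (tips-step κ) total-tips
  }
  where
  open Invariant I
  u<w = proj₁ (curve-ends< good κ)
  v<w = proj₂ (curve-ends< good κ)
  girth′ = girth⇒Girth≥4 girth≥4
  uv = Sprout.girth⇒Legal bounded u<w v<w girth′

play-invariant : ∀ {n x P} {t : Fin n → ℕ} → 1 ≤ n → (∀ i → 3 ≤ t i) → Play 𝒫₄ t x P →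
                 Invariant n (∑ (tabulate t)) x P
play-invariant 1≤n t≥3 start = initial-invariant 1≤n _ t≥3
play-invariant 1≤n t≥3 (next p m) = move-invariant (play-invariant 1≤n t≥3 p) m

-- Membership in `𝒫₄` comes from the curve and the pair: planarity because the new drawing is built
-- explicitly, girth because the pair is legal.
legal-move : ∀ {n total x P u v Rs} → Invariant n total x P → Curve [ order (graph P) ] u v (regions P) Rs →
             Legal (edges (graph P)) u v → ∃[ Q ] Move 𝒫₄ P Q
legal-move I κ uv = _ , move κ ((_ , sprout-drawn drawn κ) ,
    Girth≥4⇒girth (Sprout.Legal⇒girth bounded (proj₁ ends<) (proj₂ ends<) girth uv))
  where
  open Invariant I
  ends< = curve-ends< good κ

-- Ended positions

rotate-pair : ∀ {x y b} → x ∈ b → y ∈ b → x ≢ y → ∃[ xs ] ∃[ ys ] (b ↻ (x ∷ xs ++ y ∷ ys))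
rotate-pair {x} {y} x∈ y∈ x≢y with ∈-∃++ x∈
... | as , bs , refl with ∈-↻ (rotate as (x ∷ bs)) y∈
...   | here y≡x = ⊥-elim (x≢y (sym y≡x))
...   | there y∈′ with ∈-∃++ y∈′
...     | xs , ys , eq = xs , ys , subst ((as ++ x ∷ bs) ↻_) (cong (x ∷_) eq) (rotate as (x ∷ bs))

ended⇒¬HasLegal : ∀ {n total x P} → Invariant n total x P → Ended 𝒫₄ P →
                  ∀ {X b} → X ∈ regions P → b ∈ X → ¬ HasLegal (edges (graph P)) b
ended⇒¬HasLegal I end X∈ b∈ (x , y , x∈ , y∈ , xy) with ∈⇒↭ X∈ | ∈⇒↭ b∈ | rotate-pair x∈ y∈ (proj₁ xy)
... | _ , π | R , ρ | _ , _ , r =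
  -- Any distribution of the other components would do; all of them are put on one side.
  end (legal-move I (within {R₁ = R} {[]} π (↭-trans ρ (prep _ (↭-reflexive (sym (++-identityʳ R))))) r) xy)

ended⇒length≤1 : ∀ {n total x P} → Invariant n total x P → Ended 𝒫₄ P →
                 ∀ {X} → X ∈ regions P → length X ≤ 1
ended⇒length≤1 I end {[]} X∈ = z≤n
ended⇒length≤1 I end {b ∷ []} X∈ = ≤-refl
ended⇒length≤1 I end {b ∷ c ∷ R} X∈ with All.lookup (Invariant.good I) X∈
... | g with Good.open-tips g | AllPairs.head (Good.separated g)
ended⇒length≤1 I end {(x ∷ xs) ∷ (y ∷ ys) ∷ R} X∈ | g | _ ∷ _ ∷ _ | s ∷ _ =
  ⊥-elim (end (legal-move I
    (across (proj₂ (∈⇒↭ X∈)) refl (id-↻ (x ∷ xs)) (id-↻ (y ∷ ys)))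
    (legal s (here refl) (here refl))))
  where
  id-↻ : ∀ b → b ↻ b
  id-↻ b = subst (b ↻_) (++-identityʳ b) (rotate [] b)
ended⇒length≤1 I end {[] ∷ _} X∈ | g | () ∷ _ | _
ended⇒length≤1 I end {_ ∷ [] ∷ _} X∈ | g | _ ∷ () ∷ _ | _

-- Without legal pairs the second alternative of `Worth` is void, so each region counts at most 1.
weight≤length : ∀ {E Rs m} → (∀ {X b} → X ∈ Rs → b ∈ X → ¬ HasLegal E b) → Weight E Rs m → m ≤ length Rs
weight≤length final [] = z≤n
weight≤length {E} {X ∷ Rs} final (add V W n≤) =
  ≤-trans n≤ (+-mono-≤ (bound V) (weight≤length (λ X∈ → final (there X∈)) W))
  where
  bound : ∀ {m} → WorthR E X m → m ≤ 1
  bound (inj₁ m≤1) = m≤1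
  bound (inj₂ p) with find p
  ... | b , b∈ , inj₁ m≤1 = m≤1
  ... | b , b∈ , inj₂ (h , _) = ⊥-elim (final (here refl) b∈ h)

sum-map-≤ : ∀ {A : Set} (f g : A → ℕ) l → (∀ {x} → x ∈ l → f x ≤ g x) → ∑ (map f l) ≤ ∑ (map g l)
sum-map-≤ f g [] _ = z≤n
sum-map-≤ f g (x ∷ l) f≤g = +-mono-≤ (f≤g (here refl)) (sum-map-≤ f g l (λ x∈ → f≤g (there x∈)))

length-as-sum : ∀ {A : Set} (l : List A) → length l ≡ ∑ (map (λ _ → 1) l)
length-as-sum [] = refl
length-as-sum (_ ∷ l) = cong suc (length-as-sum l)

-- The two bounds

upper-bound : ∀ {n total x P} → 2 ≤ n → Invariant n total x P → x ≤ (n ∸ 2) + total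
upper-bound {suc (suc n)} {total} {x} {P} (s≤s (s≤s _)) I = +-cancelʳ-≤ (r + 2) x (n + total) (begin
    x + (r + 2)                      ≡⟨ +-assoc x r 2 ⟨
    x + r + 2                        ≤⟨ +-monoˡ-≤ 2 (+-monoʳ-≤ x r≤boundaries) ⟩
    x + boundaries Rs + 2            ≡⟨ euler ⟩
    r + r + (2 + n)                  ≤⟨ +-monoˡ-≤ (2 + n) (+-monoʳ-≤ r r≤total) ⟩
    r + total + (2 + n)              ≡⟨ solve 3 (λ r t n → r :+ t :+ (con 2 :+ n) := n :+ t :+ (r :+ con 2)) refl r total n ⟩
    n + total + (r + 2)              ∎)
  where
  open ≤-Reasoning
  open +-*-Solver
  open Invariant I
  Rs = regions P
  r = length Rs
  r≤boundaries : r ≤ boundaries Rs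
  r≤boundaries = ≤-trans (≤-reflexive (length-as-sum Rs))
    (sum-map-≤ _ _ Rs (λ X∈ → Good.nonempty (All.lookup good X∈)))
  length≤tipsʳ : ∀ {X} → X ∈ Rs → length X ≤ tipsʳ X
  length≤tipsʳ {X} X∈ = ≤-trans (≤-reflexive (length-as-sum X))
    (sum-map-≤ _ _ X (λ b∈ → All.lookup (Good.open-tips (All.lookup good X∈)) b∈))
  r≤total : r ≤ total
  r≤total = ≤-trans r≤boundaries (≤-trans (sum-map-≤ length tipsʳ Rs length≤tipsʳ) (≤-reflexive total-tips))

lower-bound : ∀ {n total x P} → 2 ≤ n → Invariant n total x P → Ended 𝒫₄ P → 4 + n ≤ x
lower-bound {n} {total} {x} {P} 2≤n I end = case-stage stage
  where
  open ≤-Reasoning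
  open +-*-Solver
  open Invariant I
  Rs = regions P
  r = length Rs
  boundaries≤r : boundaries Rs ≤ r
  boundaries≤r = ≤-trans (sum-map-≤ length (λ _ → 1) Rs (ended⇒length≤1 I end)) (≤-reflexive (sym (length-as-sum Rs)))
  r+n≤x+2 : r + n ≤ x + 2
  r+n≤x+2 = +-cancelˡ-≤ r (r + n) (x + 2) (begin
    r + (r + n)             ≡⟨ +-assoc r r n ⟨
    r + r + n               ≡⟨ euler ⟨
    x + boundaries Rs + 2   ≤⟨ +-monoˡ-≤ 2 (+-monoʳ-≤ x boundaries≤r) ⟩
    x + r + 2               ≡⟨ solve 2 (λ x r → x :+ r :+ con 2 := r :+ (x :+ con 2)) refl x r ⟩
    r + (x + 2)             ∎)
  case-stage : Stage x (edges (graph P)) Rs → 4 + n ≤ x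
  -- With one region and no move made, `r+n≤x+2` would read 1 + n ≤ 2.
  case-stage (opening x≡0 Rs≡ _) = ⊥-elim (<⇒≱ (s≤s 2≤n) (≤-trans (+-monoˡ-≤ n (≤-reflexive (sym (cong length Rs≡))))
    (≤-trans r+n≤x+2 (≤-reflexive (cong (_+ 2) x≡0)))))
  case-stage (middle π sp _) with find sp
  -- A special word still offers a legal pair, so the play has not ended.
  ... | b , b∈ , s = ⊥-elim (ended⇒¬HasLegal I end (∈-resp-↭ (↭-sym π) (here refl)) b∈ (Special.has-legal s))
  case-stage (late W) = +-cancelʳ-≤ 2 (4 + n) x (begin
    4 + n + 2   ≡⟨ +-comm (4 + n) 2 ⟩
    6 + n       ≤⟨ +-monoˡ-≤ n (weight≤length (ended⇒¬HasLegal I end) W) ⟩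
    r + n       ≤⟨ r+n≤x+2 ⟩
    x + 2       ∎)

infinite⇒play : ∀ {n} {t : Fin n → ℕ} {f} → InfinitePlay 𝒫₄ t f → ∀ k → Play 𝒫₄ t k (f k)
infinite⇒play {t = t} (f0 , _) 0 = subst (Play 𝒫₄ t 0) (sym f0) start
infinite⇒play inf@(_ , step) (suc k) = next (infinite⇒play inf k) (step k)

theorem3p2 : (n : ℕ) → 2 ≤ n →
    (t : Fin n → ℕ) → (∀ i → 3 ≤ t i) →
    (¬ (∃[ f ] InfinitePlay 𝒫₄ t f)) ×
    (∀ x P → Play 𝒫₄ t x P → Ended 𝒫₄ P →
    (4 + n ≤ x) × (x ≤ (n ∸ 2) + sum (tabulate t)))
theorem3p2 n 2≤n t t≥3 =
  -- `upper-bound` holds in every reachable position, so an infinite play contradicts it one move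
  -- past the bound.
  (λ (f , inf) → 1+n≰n (upper-bound 2≤n (invariant (infinite⇒play inf (suc ((n ∸ 2) + sum (tabulate t))))))) ,
  λ x P play end → lower-bound 2≤n (invariant play) end , upper-bound 2≤n (invariant play)
  where
  invariant : ∀ {x P} → Play 𝒫₄ t x P → Invariant n (sum (tabulate t)) x P
  invariant = play-invariant (≤-trans (s≤s z≤n) 2≤n) t≥3
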